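{- As $n\to\infty$, \[(3+o(1))\binom{n}{\lfloor n/2\rfloor}\le \mathrm{La}^*_R(n,\Diamond)\le \Bigl(3+\tfrac16+o(1)\Bigr)\binom{n}{\lfloor n/2\rfloor}.\]
   Context: All posets are finite. A subfamily of a family of sets is a copy of a poset $P$ if, ordered by inclusion, it is isomorphic to $P$. A coloring of a family $\mathcal{F}$ of sets is proper if $F\subsetneq F'$ in $\mathcal{F}$ implies $F,F'$ get different colors; a copy is rainbow if all its members receive distinct colors. $\mathrm{La}^*_R(n,P)$ is the maximum size of a family $\mathcal{F}\subseteq 2^{[n]}$ admitting a proper coloring with no rainbow copy of $P$. The diamond $\Diamond$ is the four-element poset $\{a,b,c,d\}$ with $a<b<d$, $a<c<d$ and $b,c$ incomparable. -}

module Defs where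

open import Data.Nat using (ℕ; _/_)
open import Data.Nat.Combinatorics using (_C_)
open import Data.Fin.Subset using (Subset; _⊆_; _⊂_)
open import Data.List using (List)
open import Data.List.Membership.Propositional using (_∈_)
open import Data.List.Relation.Unary.Unique.Propositional using (Unique)
open import Data.Product using (_×_; Σ; ∃-syntax)
open import Relation.Nullary using (¬_)
open import Relation.Binary.PropositionalEquality using (_≢_)

-- A family of subsets of [n] = {0,…,n-1}: a duplicate-free list of subsets.
Family : ℕ → Set
Family n = List (Subset n)

-- A coloring assigns a colour (a natural number) to each subset;
-- only its values on members of the family matter.
Coloring : ℕ → Set
Coloring n = Subset n → ℕ

Proper : ∀ {n} → Family n → Coloring n → Set
Proper {n} 𝓕 c = ∀ (F F' : Subset n) → F ∈ 𝓕 → F' ∈ 𝓕 → F ⊂ F' → c F ≢ c F'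

-- (a , b , c , d) forms a copy of the diamond in 𝓕:
-- a ⊊ b ⊊ d, a ⊊ c ⊊ d, b and c incomparable (this is exactly an
-- inclusion-order isomorphism onto the diamond).
DiamondCopy : ∀ {n} → Family n → Subset n → Subset n → Subset n → Subset n → Set
DiamondCopy 𝓕 a b c d =
  a ∈ 𝓕 × b ∈ 𝓕 × c ∈ 𝓕 × d ∈ 𝓕 ×
  a ⊂ b × b ⊂ d × a ⊂ c × c ⊂ d × ¬ (b ⊆ c) × ¬ (c ⊆ b)

Rainbow : ∀ {n} → Coloring n → Subset n → Subset n → Subset n → Subset n → Set
Rainbow col a b c d =
  col a ≢ col b × col a ≢ col c × col a ≢ col d ×
  col b ≢ col c × col b ≢ col d × col c ≢ col d

NoRainbowDiamond : ∀ {n} → Family n → Coloring n → Set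
NoRainbowDiamond {n} 𝓕 col =
  ∀ (a b c d : Subset n) → DiamondCopy 𝓕 a b c d → ¬ Rainbow col a b c d

-- 𝓕 ⊆ 2^[n] (as a set: no repetitions) admits a proper colouring with
-- no rainbow copy of the diamond.  La*_R(n,◇) = max { |𝓕| : Good n 𝓕 }.
Good : (n : ℕ) → Family n → Set
Good n 𝓕 = Unique 𝓕 × ∃[ col ] (Proper 𝓕 col × NoRainbowDiamond 𝓕 col)

centralBinom : ℕ → ℕ
centralBinom n = n C (n / 2)

{-# OPTIONS --safe #-}
module Submission where

open import Defs
open import Data.Nat using (ℕ; zero; suc; _+_; _*_; _∸_; _≤_; _<_; _/_; _%_; _!; z≤n; s≤s; NonZero; >-nonZero)
open import Data.Nat.Properties
open import Data.Nat.Combinatorics using (_C_; nCn≡1; nCk+nC[k+1]≡[n+1]C[k+1]; k>n⇒nCk≡0)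
open import Data.Nat.DivMod using (m≡m%n+[m/n]*n; m%n<n)
open import Data.Nat.Induction using (<-rec)
open import Data.Nat.ListAction using (sum)
open import Data.Nat.Tactic.RingSolver using (solve-∀)
open import Data.Bool using () renaming (_≟_ to _≟ᵇ_)
open import Data.Empty using (⊥-elim)
open import Data.Fin using (Fin; zero; suc)
open import Data.Fin.Subset renaming (_∈_ to _∈ˢ_; _∉_ to _∉ˢ_)
open import Data.Fin.Subset.Properties
open import Data.List using (List; []; _∷_; _++_; map; filter; foldr; length; allFin; tabulate)
open import Data.List.Properties using (map-tabulate; length-++; length-map)
open import Data.List.Membership.Propositional using (_∈_; _∉_; find; lose)
open import Data.List.Membership.Propositional.Properties using (∈-filter⁺; ∈-filter⁻; ∈-map⁺; ∈-map⁻; ∈-++⁻)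
open import Data.List.Relation.Unary.All using ([]; _∷_)
open import Data.List.Relation.Unary.AllPairs using ([]; _∷_)
open import Data.List.Relation.Unary.Any using (Any; here; there; any?)
open import Data.List.Relation.Unary.Unique.Propositional using (Unique)
import Data.List.Relation.Unary.Unique.Propositional.Properties as Unique
open import Data.Product using (_×_; _,_; proj₁; proj₂; ∃-syntax)
open import Data.Sum using (inj₁; inj₂; [_,_])
open import Data.Vec using ([]; _∷_; here; there)
open import Data.Vec.Properties using (≡-dec; ∷-injectiveʳ)
open import Function using (_∘_; id)
open import Relation.Binary.PropositionalEquality using (_≡_; _≢_; refl; sym; trans; cong; cong₂; subst; subst₂; module ≡-Reasoning)
open import Relation.Nullary using (¬_; Dec; yes; no; contradiction)
open import Relation.Unary using (Decidable)
open import Relation.Unary.Properties using (∁?)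

-- Upper bound: a diamond a < b, c < d is rainbow unless b and c share their colour, so in a family
-- without rainbow diamonds incomparability is transitive inside every open interval spanned by two
-- members: there the family is an ordinal sum of antichains. The Lubell mass, i.e. the average
-- number of members on a random maximal chain, is bounded by 3 + 1/6 on every interval [A , B], by
-- induction on the dimension: if A or B is not a member, split the chains according to their first
-- or last step. Otherwise A and B contribute 2, and the open interval contributes at most 7/6. To
-- see this in dimension m, let V be the union of the minimal and U the intersection of the maximal
-- members strictly between A and B, with |V \ A| = v, |B \ U| = w and t = |U \ V|. A chain meets
-- the lowest level only if its first step stays in V, and dually, so these two levels have mass at
-- most (v + w)/m; the remaining members lie in [V , U], and if v , w ≥ 2, induction there gives them
-- mass at most t/m + 1/6. If v = 1 then V is the only minimal member and can be removed; dually for w.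
-- Lower bound: three middle layers coloured by cardinality.

private
  variable
    n : ℕ
    X Y : Set
    A B g : Subset n
    L : Family n

-- Sums over lists

∑ : List X → (X → ℕ) → ℕ
∑ xs f = sum (map f xs)

𝟙 : {P : Set} → Dec P → ℕ
𝟙 (yes _) = 1
𝟙 (no _) = 0

∑-mono : ∀ (xs : List X) {f g : X → ℕ} → (∀ {x} → x ∈ xs → f x ≤ g x) → ∑ xs f ≤ ∑ xs g
∑-mono [] _ = z≤n
∑-mono (x ∷ xs) f≤g = +-mono-≤ (f≤g (here refl)) (∑-mono xs (f≤g ∘ there))

∑-cong : ∀ (xs : List X) {f g : X → ℕ} → (∀ x → f x ≡ g x) → ∑ xs f ≡ ∑ xs g
∑-cong [] _ = refl
∑-cong (x ∷ xs) f≡g = cong₂ _+_ (f≡g x) (∑-cong xs f≡g)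

∑-*ˡ : ∀ (xs : List X) c {f : X → ℕ} → ∑ xs (λ x → c * f x) ≡ c * ∑ xs f
∑-*ˡ [] c = sym (*-zeroʳ c)
∑-*ˡ (x ∷ xs) c {f} = trans (cong (c * f x +_) (∑-*ˡ xs c)) (sym (*-distribˡ-+ c (f x) _))

∑-*ʳ : ∀ (xs : List X) c {f : X → ℕ} → ∑ xs (λ x → f x * c) ≡ ∑ xs f * c
∑-*ʳ [] c = refl
∑-*ʳ (x ∷ xs) c {f} = trans (cong (f x * c +_) (∑-*ʳ xs c)) (sym (*-distribʳ-+ c (f x) _))

∑-+ : ∀ (xs : List X) {f g : X → ℕ} → ∑ xs (λ x → f x + g x) ≡ ∑ xs f + ∑ xs g
∑-+ [] = refl
∑-+ (x ∷ xs) {f} {g} = trans (cong (f x + g x +_) (∑-+ xs)) (lem (f x) (g x) _ _)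
  where
  lem : ∀ a b c d → a + b + (c + d) ≡ a + c + (b + d)
  lem = solve-∀

∑-zero : ∀ (xs : List X) → ∑ xs (λ _ → 0) ≡ 0
∑-zero [] = refl
∑-zero (_ ∷ xs) = ∑-zero xs

∑-swap : ∀ (xs : List X) (ys : List Y) {f : X → Y → ℕ} →
  ∑ xs (λ x → ∑ ys (f x)) ≡ ∑ ys (λ y → ∑ xs (λ x → f x y))
∑-swap [] ys = sym (∑-zero ys)
∑-swap (x ∷ xs) ys {f} = trans (cong (∑ ys (f x) +_) (∑-swap xs ys)) (sym (∑-+ ys))

module _ {P : X → Set} (P? : Decidable P) where

  ∑-filter : ∀ (xs : List X) {f : X → ℕ} → ∑ (filter P? xs) f ≡ ∑ xs (λ x → 𝟙 (P? x) * f x)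
  ∑-filter [] = refl
  ∑-filter (x ∷ xs) {f} with P? x
  ... | yes _ = cong₂ _+_ (sym (+-identityʳ (f x))) (∑-filter xs)
  ... | no _ = ∑-filter xs

  ∑-split : ∀ (xs : List X) {f : X → ℕ} →
    ∑ xs f ≡ ∑ (filter P? xs) f + ∑ (filter (∁? P?) xs) f
  ∑-split [] = refl
  ∑-split (x ∷ xs) {f} with P? x
  ... | yes _ = trans (cong (f x +_) (∑-split xs)) (sym (+-assoc (f x) _ _))
  ... | no _ = trans (cong (f x +_) (∑-split xs)) (lem (f x) (∑ (filter P? xs) f) (∑ (filter (∁? P?) xs) f))
    where
    lem : ∀ a b c → a + (b + c) ≡ b + (a + c)
    lem = solve-∀

∑-subsingleton : ∀ {xs : List X} {y} {f : X → ℕ} → Unique xs → (∀ {x} → x ∈ xs → x ≡ y) → ∑ xs f ≤ f y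
∑-subsingleton {xs = []} _ _ = z≤n
∑-subsingleton {xs = x ∷ []} {f = f} _ all = ≤-reflexive (trans (+-identityʳ _) (cong f (all (here refl))))
∑-subsingleton {xs = x ∷ x′ ∷ _} ((x≢x′ ∷ _) ∷ _) all =
  contradiction (trans (all (here refl)) (sym (all (there (here refl))))) x≢x′

∑-∈ : ∀ (p : Subset n) → ∑ (allFin n) (λ i → 𝟙 (i ∈? p)) ≡ ∣ p ∣
∑-∈ [] = refl
∑-∈ {suc n} (s ∷ p) = trans (cong (𝟙 (zero ∈? (s ∷ p)) +_) tail) (head s)
  where
  drop : ∀ i → 𝟙 (suc i ∈? (s ∷ p)) ≡ 𝟙 (i ∈? p)
  drop i with i ∈? p
  ... | yes _ = refl
  ... | no _ = refl
  in-s∷p : Fin (suc n) → ℕ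
  in-s∷p i = 𝟙 (i ∈? (s ∷ p))
  tail : ∑ (tabulate suc) (λ i → 𝟙 (i ∈? (s ∷ p))) ≡ ∣ p ∣
  tail = trans (cong sum (trans (map-tabulate suc in-s∷p) (sym (map-tabulate id (in-s∷p ∘ suc)))))
    (trans (∑-cong (allFin n) drop) (∑-∈ p))
  head : ∀ s → 𝟙 (zero ∈? (s ∷ p)) + ∣ p ∣ ≡ ∣ s ∷ p ∣
  head inside = refl
  head outside = refl

-- Set differences, complements and dimensions of intervals

_≟ˢ_ : (A B : Subset n) → Dec (A ≡ B)
_≟ˢ_ = ≡-dec _≟ᵇ_

x∈p─q⇒x∉q : ∀ {x} (p q : Subset n) → x ∈ˢ p ─ q → x ∉ˢ q
x∈p─q⇒x∉q (_ ∷ p) (_ ∷ q) (there x∈) (there x∈q) = x∈p─q⇒x∉q p q x∈ x∈q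
x∈p─q⇒x∉q (_ ∷ p) (inside ∷ q) () here

⊆∧⊉⇒⊂ : ∀ {A B : Subset n} → A ⊆ B → ¬ (B ⊆ A) → A ⊂ B
⊆∧⊉⇒⊂ {A = A} {B} A⊆B B⊈A with nonempty? (B ─ A)
... | yes (x , x∈) = A⊆B , x , p─q⊆p B A x∈ , x∈p─q⇒x∉q B A x∈
... | no empty = ⊥-elim (B⊈A B⊆A)
  where
  B⊆A : B ⊆ A
  B⊆A {x} x∈B with x ∈? A
  ... | yes x∈A = x∈A
  ... | no x∉A = contradiction (x , x∈p∧x∉q⇒x∈p─q x∈B x∉A) empty

⊆∧≢⇒⊂ : ∀ {A B : Subset n} → A ⊆ B → A ≢ B → A ⊂ B
⊆∧≢⇒⊂ A⊆B A≢B = ⊆∧⊉⇒⊂ A⊆B (λ B⊆A → A≢B (⊆-antisym A⊆B B⊆A))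

-- For `A ⊆ B` this is the dimension of the interval [A , B].
d : Subset n → Subset n → ℕ
d A B = ∣ B ─ A ∣

∣A∣+d : ∀ {A B : Subset n} → A ⊆ B → ∣ A ∣ + d A B ≡ ∣ B ∣
∣A∣+d {A = []} {[]} _ = refl
∣A∣+d {A = inside ∷ A} {inside ∷ B} A⊆B = cong suc (∣A∣+d (drop-∷-⊆ A⊆B))
∣A∣+d {A = inside ∷ A} {outside ∷ B} A⊆B with () ← A⊆B here
∣A∣+d {A = outside ∷ A} {inside ∷ B} A⊆B = trans (+-suc _ _) (cong suc (∣A∣+d (drop-∷-⊆ A⊆B)))
∣A∣+d {A = outside ∷ A} {outside ∷ B} A⊆B = ∣A∣+d (drop-∷-⊆ A⊆B)

d-trans : ∀ {A g B : Subset n} → A ⊆ g → g ⊆ B → d A g + d g B ≡ d A B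
d-trans {A = A} {g} {B} A⊆g g⊆B = +-cancelˡ-≡ ∣ A ∣ _ _ (begin
  ∣ A ∣ + (d A g + d g B) ≡⟨ +-assoc ∣ A ∣ _ _ ⟨
  ∣ A ∣ + d A g + d g B ≡⟨ cong (_+ d g B) (∣A∣+d A⊆g) ⟩
  ∣ g ∣ + d g B ≡⟨ ∣A∣+d g⊆B ⟩
  ∣ B ∣ ≡⟨ ∣A∣+d (λ x∈ → g⊆B (A⊆g x∈)) ⟨
  ∣ A ∣ + d A B ∎)
  where open ≡-Reasoning

d-self : ∀ (A : Subset n) → d A A ≡ 0
d-self A = +-cancelˡ-≡ ∣ A ∣ _ _ (trans (∣A∣+d {A = A} id) (sym (+-identityʳ _)))

d-pos : ∀ {A B : Subset n} → A ⊂ B → 0 < d A B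
d-pos {A = A} {B} A⊂B = +-cancelˡ-< ∣ A ∣ _ _ (begin-strict
  ∣ A ∣ + 0 ≡⟨ +-identityʳ _ ⟩
  ∣ A ∣ <⟨ p⊂q⇒∣p∣<∣q∣ A⊂B ⟩
  ∣ B ∣ ≡⟨ ∣A∣+d (proj₁ A⊂B) ⟨
  ∣ A ∣ + d A B ∎)
  where open ≤-Reasoning

d≡0⇒≡ : ∀ {A B : Subset n} → A ⊆ B → d A B ≡ 0 → A ≡ B
d≡0⇒≡ {A = A} {B} A⊆B d≡0 with A ≟ˢ B
... | yes A≡B = A≡B
... | no A≢B = contradiction (sym d≡0) (<⇒≢ (d-pos (⊆∧≢⇒⊂ A⊆B A≢B)))

d-insert : ∀ {A : Subset n} {a} → a ∉ˢ A → d A (A ∪ ⁅ a ⁆) ≡ 1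
d-insert {A = A} {a} a∉A = trans (cong ∣_∣ (⊆-antisym to from)) (∣⁅x⁆∣≡1 a)
  where
  to : (A ∪ ⁅ a ⁆) ─ A ⊆ ⁅ a ⁆
  to x∈ with x∈p∪q⁻ A ⁅ a ⁆ (p─q⊆p _ A x∈)
  ... | inj₁ x∈A = contradiction x∈A (x∈p─q⇒x∉q (A ∪ ⁅ a ⁆) A x∈)
  ... | inj₂ x∈a = x∈a
  from : ⁅ a ⁆ ⊆ (A ∪ ⁅ a ⁆) ─ A
  from x∈ with refl ← x∈⁅y⁆⇒x≡y a x∈ = x∈p∧x∉q⇒x∈p─q (q⊆p∪q A ⁅ a ⁆ x∈) a∉A

insert-⊆ : ∀ {A B : Subset n} {a} → A ⊆ B → a ∈ˢ B → A ∪ ⁅ a ⁆ ⊆ B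
insert-⊆ {A = A} {a = a} A⊆B a∈B x∈ with x∈p∪q⁻ A ⁅ a ⁆ x∈
... | inj₁ x∈A = A⊆B x∈A
... | inj₂ x∈a with refl ← x∈⁅y⁆⇒x≡y a x∈a = a∈B

d-∁ : ∀ (A B : Subset n) → d (∁ B) (∁ A) ≡ d A B
d-∁ [] [] = refl
d-∁ (inside ∷ A) (inside ∷ B) = d-∁ A B
d-∁ (inside ∷ A) (outside ∷ B) = d-∁ A B
d-∁ (outside ∷ A) (inside ∷ B) = cong suc (d-∁ A B)
d-∁ (outside ∷ A) (outside ∷ B) = d-∁ A B

∁-involutive : ∀ (A : Subset n) → ∁ (∁ A) ≡ A
∁-involutive [] = refl
∁-involutive (inside ∷ A) = cong (inside ∷_) (∁-involutive A)
∁-involutive (outside ∷ A) = cong (outside ∷_) (∁-involutive A)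

∁-injective : ∀ {A B : Subset n} → ∁ A ≡ ∁ B → A ≡ B
∁-injective {A = A} {B} eq = trans (sym (∁-involutive A)) (trans (cong ∁ eq) (∁-involutive B))

-- Counting maximal chains

-- The number of maximal chains of the interval [A , B] passing through g.
ω : Subset n → Subset n → Subset n → ℕ
ω A B g = d A g ! * d g B !

-- Complementation maps [A , B] onto [∁ B , ∁ A] and reverses inclusion. Through it, statements
-- about bottom ends carry over to top ends.
ω-∁ : ∀ (A B g : Subset n) → ω (∁ B) (∁ A) (∁ g) ≡ ω A B g
ω-∁ A B g = trans (cong₂ (λ x y → x ! * y !) (d-∁ g B) (d-∁ A g)) (*-comm (d g B !) _)

∑-ω-∁ : ∀ (A B : Subset n) L → ∑ (map ∁ L) (ω (∁ B) (∁ A)) ≡ ∑ L (ω A B)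
∑-ω-∁ A B [] = refl
∑-ω-∁ A B (g ∷ L) = cong₂ _+_ (ω-∁ A B g) (∑-ω-∁ A B L)

-- A maximal chain through g ≠ A leaves A towards some A ∪ ⁅ a ⁆ with a ∈ g.
ω-step : ∀ {A B U g : Subset n} → A ⊂ g → g ⊆ U →
  ω A B g ≤ ∑ (allFin n) (λ a → 𝟙 (a ∈? (U ─ A)) * (𝟙 (a ∈? g) * ω (A ∪ ⁅ a ⁆) B g))
ω-step {n} {A} {B} {U} {g} A⊂g g⊆U with d A g in eq | d-pos A⊂g
... | suc j | _ = begin
  (suc j * j !) * d g B ! ≡⟨ *-assoc (suc j) (j !) _ ⟩
  suc j * (j ! * d g B !) ≡⟨ cong (_* (j ! * d g B !)) (trans (sym eq) (sym (∑-∈ (g ─ A)))) ⟩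
  ∑ (allFin n) (λ a → 𝟙 (a ∈? (g ─ A))) * (j ! * d g B !) ≡⟨ ∑-*ʳ (allFin n) _ ⟨
  ∑ (allFin n) (λ a → 𝟙 (a ∈? (g ─ A)) * (j ! * d g B !)) ≤⟨ ∑-mono (allFin n) (λ {a} _ → pointwise a) ⟩
  ∑ (allFin n) (λ a → 𝟙 (a ∈? (U ─ A)) * (𝟙 (a ∈? g) * ω (A ∪ ⁅ a ⁆) B g)) ∎
  where
  open ≤-Reasoning
  pointwise : ∀ a → 𝟙 (a ∈? (g ─ A)) * (j ! * d g B !) ≤ 𝟙 (a ∈? (U ─ A)) * (𝟙 (a ∈? g) * ω (A ∪ ⁅ a ⁆) B g)
  pointwise a with a ∈? (g ─ A)
  ... | no _ = z≤n
  ... | yes a∈ with a ∈? (U ─ A) | a ∈? g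
  ... | no a∉ | _ = contradiction (x∈p∧x∉q⇒x∈p─q (g⊆U (p─q⊆p g A a∈)) (x∈p─q⇒x∉q g A a∈)) a∉
  ... | yes _ | no a∉g = contradiction (p─q⊆p g A a∈) a∉g
  ... | yes _ | yes a∈g = ≤-reflexive (trans (cong (λ x → x ! * d g B ! + 0) j≡)
      (sym (+-identityʳ _)))
    where
    j≡ : j ≡ d (A ∪ ⁅ a ⁆) g
    j≡ = suc-injective (trans (sym eq) (trans
      (sym (d-trans (p⊆p∪q ⁅ a ⁆) (insert-⊆ (proj₁ A⊂g) a∈g)))
      (cong (_+ d (A ∪ ⁅ a ⁆) g) (d-insert (x∈p─q⇒x∉q g A a∈)))))

-- The chains are sorted by their first step `a`. Only the `d A U` steps inside `U` can lead to a
-- member, and after such a step the chain lies in [A ∪ ⁅ a ⁆ , B]. The factor `c` clears the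
-- denominator of a fractional mass bound.
∑-step : ∀ {A B U : Subset n} {L c K} →
  (∀ {g} → g ∈ L → A ⊂ g × g ⊆ U) →
  (∀ a → a ∈ˢ U ─ A → c * ∑ (filter (a ∈?_) L) (ω (A ∪ ⁅ a ⁆) B) ≤ K) →
  c * ∑ L (ω A B) ≤ d A U * K
∑-step {n} {A} {B} {U} {L} {c} {K} within bound = begin
  c * ∑ L (ω A B) ≤⟨ *-monoʳ-≤ c (∑-mono L λ g∈ → ω-step {B = B} (proj₁ (within g∈)) (proj₂ (within g∈))) ⟩
  c * ∑ L (λ g → ∑ (allFin n) (λ a → 𝟙 (a ∈? (U ─ A)) * (𝟙 (a ∈? g) * ω (A ∪ ⁅ a ⁆) B g)))
    ≡⟨ cong (c *_) (∑-swap L (allFin n)) ⟩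
  c * ∑ (allFin n) (λ a → ∑ L (λ g → 𝟙 (a ∈? (U ─ A)) * (𝟙 (a ∈? g) * ω (A ∪ ⁅ a ⁆) B g)))
    ≡⟨ ∑-*ˡ (allFin n) c ⟨
  ∑ (allFin n) (λ a → c * ∑ L (λ g → 𝟙 (a ∈? (U ─ A)) * (𝟙 (a ∈? g) * ω (A ∪ ⁅ a ⁆) B g)))
    ≤⟨ ∑-mono (allFin n) (λ {a} _ → pointwise a) ⟩
  ∑ (allFin n) (λ a → 𝟙 (a ∈? (U ─ A)) * K) ≡⟨ ∑-*ʳ (allFin n) K ⟩
  ∑ (allFin n) (λ a → 𝟙 (a ∈? (U ─ A))) * K ≡⟨ cong (_* K) (∑-∈ (U ─ A)) ⟩
  d A U * K ∎
  where
  open ≤-Reasoning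
  pointwise : ∀ a → c * ∑ L (λ g → 𝟙 (a ∈? (U ─ A)) * (𝟙 (a ∈? g) * ω (A ∪ ⁅ a ⁆) B g)) ≤ 𝟙 (a ∈? (U ─ A)) * K
  pointwise a with a ∈? (U ─ A)
  ... | no _ = ≤-reflexive (trans (cong (c *_) (∑-zero L)) (*-zeroʳ c))
  ... | yes a∈ = begin
    c * ∑ L (λ g → 𝟙 (a ∈? g) * ω (A ∪ ⁅ a ⁆) B g + 0) ≡⟨ cong (c *_) (∑-cong L (λ g → +-identityʳ (𝟙 (a ∈? g) * ω (A ∪ ⁅ a ⁆) B g))) ⟩
    c * ∑ L (λ g → 𝟙 (a ∈? g) * ω (A ∪ ⁅ a ⁆) B g) ≡⟨ cong (c *_) (∑-filter (a ∈?_) L) ⟨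
    c * ∑ (filter (a ∈?_) L) (ω (A ∪ ⁅ a ⁆) B) ≤⟨ bound a a∈ ⟩
    K ≡⟨ +-identityʳ K ⟨
    K + 0 ∎

-- Binomial coefficients

-- The binomial coefficient of a + b over a, by Pascal's rule.
binom : ℕ → ℕ → ℕ
binom zero b = 1
binom (suc a) zero = 1
binom (suc a) (suc b) = binom a (suc b) + binom (suc a) b

binom-zeroʳ : ∀ a → binom a 0 ≡ 1
binom-zeroʳ zero = refl
binom-zeroʳ (suc a) = refl

-- Splitting `suc a` off one factorial and `suc b` off the other turns both summands of Pascal's
-- rule into multiples of the same factorial.
binom-! : ∀ a b → binom a b * (a ! * b !) ≡ (a + b) !
binom-! zero b = trans (+-identityʳ _) (+-identityʳ _)
binom-! (suc a) zero = trans (+-identityʳ _) (trans (*-identityʳ _) (cong _! (sym (+-identityʳ (suc a)))))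
binom-! (suc a) (suc b) = begin
  (binom a (suc b) + binom (suc a) b) * (suc a ! * suc b !)
    ≡⟨ lem a b (binom a (suc b)) (binom (suc a) b) (a !) (b !) ⟩
  suc a * (binom a (suc b) * (a ! * suc b !)) + suc b * (binom (suc a) b * (suc a ! * b !))
    ≡⟨ cong₂ (λ x y → suc a * x + suc b * y) (binom-! a (suc b)) (trans (binom-! (suc a) b) (cong _! (sym (+-suc a b)))) ⟩
  suc a * (a + suc b) ! + suc b * (a + suc b) !
    ≡⟨ *-distribʳ-+ ((a + suc b) !) (suc a) (suc b) ⟨
  (suc a + suc b) ! ∎
  where
  open ≡-Reasoning
  lem : ∀ a b p q x y →
    (p + q) * (suc a * x * (suc b * y)) ≡ suc a * (p * (x * (suc b * y))) + suc b * (q * (suc a * x * y))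
  lem = solve-∀

C≡binom : ∀ a b → (a + b) C a ≡ binom a b
C≡binom zero b = refl
C≡binom (suc a) zero = trans (cong (_C suc a) (+-identityʳ (suc a))) (nCn≡1 (suc a))
C≡binom (suc a) (suc b) = trans (sym (nCk+nC[k+1]≡[n+1]C[k+1] (a + suc b) a))
  (cong₂ _+_ (C≡binom a (suc b)) (trans (cong (_C suc a) (+-suc a b)) (C≡binom (suc a) b)))

binom-monoˡ : ∀ r v w → binom v w ≤ binom v (r + w)
binom-monoˡ zero v w = ≤-refl
binom-monoˡ (suc r) v w = ≤-trans (binom-monoˡ r v w) (one v (r + w))
  where
  one : ∀ v w → binom v w ≤ binom v (suc w)
  one zero w = ≤-refl
  one (suc v) w = m≤n+m _ _

binom-monoʳ : ∀ s v w → binom v w ≤ binom (s + v) w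
binom-monoʳ zero v w = ≤-refl
binom-monoʳ (suc s) v w = ≤-trans (binom-monoʳ s v w) (one (s + v) w)
  where
  one : ∀ v w → binom v w ≤ binom (suc v) w
  one v zero = ≤-reflexive (binom-zeroʳ v)
  one v (suc w) = m≤m+n _ _

-- A single term of Vandermonde's identity. Pascal's rule is applied to the first factor with `v`
-- and `w` fixed; the base cases are monotonicity.
binom-* : ∀ s r v w → binom s r * binom v w ≤ binom (s + v) (r + w)
binom-* zero r v w = ≤-trans (≤-reflexive (+-identityʳ _)) (binom-monoˡ r v w)
binom-* (suc s) zero v w = ≤-trans (≤-reflexive (+-identityʳ _)) (binom-monoʳ (suc s) v w)
binom-* (suc s) (suc r) v w = ≤-trans (≤-reflexive (*-distribʳ-+ (binom v w) (binom s (suc r)) _))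
  (+-mono-≤ (binom-* s (suc r) v w) (binom-* (suc s) r v w))

binom-one : ∀ j → binom 1 j ≡ suc j
binom-one zero = refl
binom-one (suc j) = cong suc (binom-one j)

binom-oneʳ : ∀ i → binom i 1 ≡ suc i
binom-oneʳ zero = refl
binom-oneʳ (suc i) = trans (+-comm (binom i 1) 1) (cong suc (binom-oneʳ i))

-- Equality holds at `i = j = 0`, and each Pascal step along the boundary adds a coefficient of at
-- least 4. The growth pays for the larger masses in `closedMass-binom`.
binom-linear : ∀ i j → 6 + 4 * (i + j) ≤ binom (2 + i) (2 + j)
binom-linear zero zero = ≤-refl
binom-linear zero (suc j) = begin
  6 + 4 * suc j ≡⟨ lem j ⟩
  4 + (6 + 4 * j) ≤⟨ +-mono-≤ (≤-trans (m≤m+n 4 j) (≤-reflexive (sym (binom-one (3 + j))))) (binom-linear zero j) ⟩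
  binom 1 (3 + j) + binom 2 (2 + j) ∎
  where
  open ≤-Reasoning
  lem : ∀ j → 6 + 4 * suc j ≡ 4 + (6 + 4 * j)
  lem = solve-∀
binom-linear (suc i) zero = begin
  6 + 4 * (suc i + 0) ≡⟨ lem i ⟩
  6 + 4 * (i + 0) + 4 ≤⟨ +-mono-≤ (binom-linear i zero) (≤-trans (m≤m+n 4 i) (≤-reflexive (sym (binom-oneʳ (3 + i))))) ⟩
  binom (2 + i) 2 + binom (3 + i) 1 ∎
  where
  open ≤-Reasoning
  lem : ∀ i → 6 + 4 * (suc i + 0) ≡ 6 + 4 * (i + 0) + 4
  lem = solve-∀
binom-linear (suc i) (suc j) = begin
  6 + 4 * (suc i + suc j) ≤⟨ m≤m+n _ (6 + 4 * (i + j)) ⟩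
  6 + 4 * (suc i + suc j) + (6 + 4 * (i + j)) ≡⟨ lem i j ⟩
  6 + 4 * (i + suc j) + (6 + 4 * (suc i + j)) ≤⟨ +-mono-≤ (binom-linear i (suc j)) (binom-linear (suc i) j) ⟩
  binom (2 + i) (3 + j) + binom (3 + i) (2 + j) ∎
  where
  open ≤-Reasoning
  lem : ∀ i j → 6 + 4 * (suc i + suc j) + (6 + 4 * (i + j)) ≡ 6 + 4 * (i + suc j) + (6 + 4 * (suc i + j))
  lem = solve-∀

-- Arithmetic of the mass bounds

-- Six times the Lubell mass allowed to a weak order strictly inside, respectively inside, an
-- interval of dimension m.
openMass closedMass : ℕ → ℕ
openMass 0 = 0
openMass 1 = 0
openMass 2 = 6
openMass (suc (suc (suc _))) = 7
closedMass 0 = 6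
closedMass 1 = 12
closedMass 2 = 18
closedMass (suc (suc (suc _))) = 19

6≤openMass : ∀ m → 6 ≤ openMass (2 + m)
6≤openMass zero = ≤-refl
6≤openMass (suc m) = m≤n+m 6 1

openMass≤7 : ∀ m → openMass m ≤ 7
openMass≤7 0 = z≤n
openMass≤7 1 = z≤n
openMass≤7 2 = m≤n+m 6 1
openMass≤7 (suc (suc (suc _))) = ≤-refl

closedMass≡12+ : ∀ m → closedMass (suc m) ≡ 12 + openMass (suc m)
closedMass≡12+ 0 = refl
closedMass≡12+ 1 = refl
closedMass≡12+ (suc (suc _)) = refl

-- This is the recursion behind `peelAtom` in dimension `2 + m`: an atom has mass 1/(2 + m), and the
-- members above it at most (1 + m)/(2 + m) times the mass allowed one dimension lower.
openMass-step : ∀ m → 6 + suc m * openMass (suc m) ≤ openMass (2 + m) * (2 + m)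
openMass-step 0 = m≤n+m 6 6
openMass-step 1 = m≤n+m 18 3
openMass-step (suc (suc m)) = begin
  6 + (3 + m) * 7 ≤⟨ m≤n+m _ 1 ⟩
  7 + (3 + m) * 7 ≡⟨ *-comm (4 + m) 7 ⟩
  7 * (4 + m) ∎
  where open ≤-Reasoning

-- The inner levels lie in a subinterval of dimension `t`, and their mass in the whole interval is
-- smaller by the binomial factor. What is left must not exceed t/m + 1/6.
closedMass-binom : ∀ i j t → let m = (2 + i) + t + (2 + j) in
  m * closedMass t ≤ (m + 6 * t) * binom (2 + i) (2 + j)
closedMass-binom i j t = ≤-trans (poly t) (*-monoʳ-≤ ((2 + i) + t + (2 + j) + 6 * t) (binom-linear i j))
  where
  slack : ∀ {x y z} → y ≡ x + z → x ≤ y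
  slack {x} {y} {z} eq = ≤-trans (m≤m+n x z) (≤-reflexive (sym eq))
  poly : ∀ t → ((2 + i) + t + (2 + j)) * closedMass t ≤ ((2 + i) + t + (2 + j) + 6 * t) * (6 + 4 * (i + j))
  -- Each `z` is the exact difference of the two sides. At `i = j = 0` it vanishes for `t = 0` and
  -- `t = 2`: these cases leave no room below the summand 1/6.
  poly 0 = slack {z = (4 + i + j) * (4 * (i + j))} (lem i j)
    where
    lem : ∀ i j → ((2 + i) + 0 + (2 + j) + 6 * 0) * (6 + 4 * (i + j))
      ≡ ((2 + i) + 0 + (2 + j)) * 6 + (4 + i + j) * (4 * (i + j))
    lem = solve-∀
  poly 1 = slack {z = 6 + 38 * (i + j) + 4 * ((i + j) * (i + j))} (lem i j)
    where
    lem : ∀ i j → ((2 + i) + 1 + (2 + j) + 6 * 1) * (6 + 4 * (i + j))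
      ≡ ((2 + i) + 1 + (2 + j)) * 12 + (6 + 38 * (i + j) + 4 * ((i + j) * (i + j)))
    lem = solve-∀
  poly 2 = slack {z = 60 * (i + j) + 4 * ((i + j) * (i + j))} (lem i j)
    where
    lem : ∀ i j → ((2 + i) + 2 + (2 + j) + 6 * 2) * (6 + 4 * (i + j))
      ≡ ((2 + i) + 2 + (2 + j)) * 18 + (60 * (i + j) + 4 * ((i + j) * (i + j)))
    lem = solve-∀
  poly (suc (suc (suc z))) = slack {z = 17 + 87 * (i + j) + 23 * z + 4 * ((i + j) * (i + j)) + 28 * (z * (i + j))} (lem i j z)
    where
    lem : ∀ i j z → ((2 + i) + (3 + z) + (2 + j) + 6 * (3 + z)) * (6 + 4 * (i + j))
      ≡ ((2 + i) + (3 + z) + (2 + j)) * 19 + (17 + 87 * (i + j) + 23 * z + 4 * ((i + j) * (i + j)) + 28 * (z * (i + j)))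
    lem = solve-∀

-- Antichains and the LYM inequality

Within Inside : Subset n → Subset n → Family n → Set
Within A B L = ∀ {g} → g ∈ L → A ⊆ g × g ⊆ B
Inside A B L = ∀ {g} → g ∈ L → A ⊂ g × g ⊂ B

Antichain : Family n → Set
Antichain L = ∀ {g h} → g ∈ L → h ∈ L → g ⊆ h → g ≡ h

d-step : ∀ {A B : Subset n} {a m} → A ⊆ B → a ∈ˢ B → a ∉ˢ A → d A B ≡ suc m → d (A ∪ ⁅ a ⁆) B ≡ m
d-step {A = A} {B} {a} A⊆B a∈B a∉A eq = suc-injective (trans (sym (trans
  (sym (d-trans (p⊆p∪q ⁅ a ⁆) (insert-⊆ A⊆B a∈B)))
  (cong (_+ d (A ∪ ⁅ a ⁆) B) (d-insert a∉A)))) eq)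

ω-bottom : ∀ (A B : Subset n) → ω A B A ≡ d A B !
ω-bottom A B = trans (cong (λ k → k ! * d A B !) (d-self A)) (+-identityʳ _)

ω-top : ∀ (A B : Subset n) → ω A B B ≡ d A B !
ω-top A B = trans (cong (λ k → d A B ! * k !) (d-self B)) (*-identityʳ _)

filter-within : ∀ {a} → Within A B L → Within (A ∪ ⁅ a ⁆) B (filter (a ∈?_) L)
filter-within {L = L} {a = a} within g∈ with ∈-filter⁻ (a ∈?_) {xs = L} g∈
... | g∈L , a∈g = insert-⊆ (proj₁ (within g∈L)) a∈g , proj₂ (within g∈L)

-- Induction on the dimension, mutual with `∑-below`. If `A` is a member, it is the only one;
-- otherwise every member is reached after a first step, so `∑-below` applies with `U = B`.
LYM : ∀ m {A B : Subset n} {L} → Unique L → Antichain L → Within A B L → A ⊆ B → d A B ≡ m →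
  ∑ L (ω A B) ≤ m !

-- A chain can only meet a family of nonempty subsets of U if its first step stays in U.
∑-below : ∀ m {A B U : Subset n} {L} → Unique L → Antichain L →
  (∀ {g} → g ∈ L → A ⊂ g × g ⊆ U) → A ⊆ U → U ⊆ B → d A B ≡ suc m →
  ∑ L (ω A B) ≤ d A U * m !
∑-below m {A} {B} {U} {L} unique anti within A⊆U U⊆B eq =
  subst (_≤ d A U * m !) (+-identityʳ _) (∑-step {B = B} {c = 1} within bound)
  where
  bound : ∀ a → a ∈ˢ U ─ A → 1 * ∑ (filter (a ∈?_) L) (ω (A ∪ ⁅ a ⁆) B) ≤ m !
  bound a a∈ = ≤-trans (≤-reflexive (+-identityʳ _)) (LYM m
    (Unique.filter⁺ (a ∈?_) unique)
    (λ g∈ h∈ → anti (proj₁ (∈-filter⁻ (a ∈?_) {xs = L} g∈)) (proj₁ (∈-filter⁻ (a ∈?_) {xs = L} h∈)))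
    (filter-within {L = L} (λ g∈ → proj₁ (proj₁ (within g∈)) , U⊆B ∘ proj₂ (within g∈)))
    (insert-⊆ (U⊆B ∘ A⊆U) (U⊆B (p─q⊆p U A a∈)))
    (d-step (U⊆B ∘ A⊆U) (U⊆B (p─q⊆p U A a∈)) (x∈p─q⇒x∉q U A a∈) eq))

LYM m {A} {B} {L} unique anti within A⊆B eq with any? (A ≟ˢ_) L
... | yes A∈L = ≤-trans
  (∑-subsingleton unique (λ g∈ → sym (anti A∈L g∈ (proj₁ (within g∈)))))
  (≤-reflexive (trans (ω-bottom A B) (cong _! eq)))
LYM zero {L = []} unique anti within A⊆B eq | no A∉L = z≤n
LYM zero {L = _ ∷ _} unique anti within A⊆B eq | no A∉L with within (here refl)
... | A⊆g , g⊆B = contradiction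
  (here (d≡0⇒≡ A⊆g (m+n≡0⇒m≡0 _ (trans (d-trans A⊆g g⊆B) eq)))) A∉L
LYM (suc m) {A} {B} {L} unique anti within A⊆B eq | no A∉L = subst (λ k → ∑ L (ω A B) ≤ k * m !) eq
  (∑-below m unique anti (λ g∈ → ⊆∧≢⇒⊂ (proj₁ (within g∈)) (λ { refl → A∉L g∈ }) , proj₂ (within g∈))
    A⊆B id eq)

-- The dual of `∑-below`, obtained by complementing all sets.
∑-above : ∀ m {A B U : Subset n} {L} → Unique L → Antichain L →
  (∀ {g} → g ∈ L → U ⊆ g × g ⊂ B) → A ⊆ U → U ⊆ B → d A B ≡ suc m →
  ∑ L (ω A B) ≤ d U B * m !
∑-above m {A} {B} {U} {L} unique anti within A⊆U U⊆B eq = begin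
  ∑ L (ω A B) ≡⟨ ∑-ω-∁ A B L ⟨
  ∑ (map ∁ L) (ω (∁ B) (∁ A)) ≤⟨ ∑-below m (Unique.map⁺ ∁-injective unique) anti′ within′
    (p⊆q⇒∁p⊇∁q U⊆B) (p⊆q⇒∁p⊇∁q A⊆U) (trans (d-∁ A B) eq) ⟩
  d (∁ B) (∁ U) * m ! ≡⟨ cong (_* m !) (d-∁ U B) ⟩
  d U B * m ! ∎
  where
  open ≤-Reasoning
  anti′ : Antichain (map ∁ L)
  anti′ g∈ h∈ ∁g⊆∁h with ∈-map⁻ ∁ g∈ | ∈-map⁻ ∁ h∈
  ... | g , g∈L , refl | h , h∈L , refl = sym (cong ∁ (anti h∈L g∈L (∁p⊆∁q⇒p⊇q ∁g⊆∁h)))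
  within′ : ∀ {g} → g ∈ map ∁ L → ∁ B ⊂ g × g ⊆ ∁ U
  within′ g∈ with ∈-map⁻ ∁ g∈
  ... | g , g∈L , refl = p⊂q⇒∁p⊃∁q (proj₂ (within g∈L)) , p⊆q⇒∁p⊇∁q (proj₁ (within g∈L))

-- Weak orders in open and closed intervals

-- Incomparability is transitive.
WeakOrder : Family n → Set
WeakOrder L = ∀ {x y z} → x ∈ L → y ∈ L → z ∈ L →
  ¬ (x ⊆ y) → ¬ (y ⊆ x) → ¬ (y ⊆ z) → ¬ (z ⊆ y) → ¬ (x ⊂ z)

-- Ranges over all intervals of dimension `m`, because the induction on the dimension moves both
-- ends.
OpenBound : ℕ → ℕ → Set
OpenBound n m = ∀ {A B : Subset n} {L} → A ⊆ B → d A B ≡ m → Unique L → Inside A B L → WeakOrder L →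
  6 * ∑ L (ω A B) ≤ openMass m * m !

interior : Subset n → Subset n → Family n → Family n
interior A B L = filter (∁? (_≟ˢ B)) (filter (∁? (_≟ˢ A)) L)

interior⊆ : ∀ (A B : Subset n) {L} → g ∈ interior A B L → g ∈ L × g ≢ A × g ≢ B
interior⊆ A B {L} g∈ with ∈-filter⁻ (∁? (_≟ˢ B)) {xs = filter (∁? (_≟ˢ A)) L} g∈
... | g∈′ , g≢B with ∈-filter⁻ (∁? (_≟ˢ A)) {xs = L} g∈′
... | g∈L , g≢A = g∈L , g≢A , g≢B

interior-inside : Within A B L → Inside A B (interior A B L)
interior-inside {A = A} {B} {L} within g∈ with interior⊆ A B {L} g∈
... | g∈L , g≢A , g≢B = ⊆∧≢⇒⊂ (proj₁ (within g∈L)) (g≢A ∘ sym) , ⊆∧≢⇒⊂ (proj₂ (within g∈L)) g≢B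

filter-weak : ∀ {P : Subset n → Set} (P? : Decidable P) → WeakOrder L → WeakOrder (filter P? L)
filter-weak {L = L} P? weak x∈ y∈ z∈ = weak (sub x∈) (sub y∈) (sub z∈)
  where
  sub : ∀ {g} → g ∈ filter P? L → g ∈ L
  sub = proj₁ ∘ ∈-filter⁻ P? {xs = L}

-- Every chain passes through both ends, so each end adds at most mass 1, which is 6 of the 12 in
-- `closedMass≡12+`. In dimension 0 the ends coincide and count once.
closedBound : ∀ m {A B : Subset n} {L} → A ⊆ B → d A B ≡ m → Unique L → Within A B L →
  6 * ∑ (interior A B L) (ω A B) ≤ openMass m * m ! → 6 * ∑ L (ω A B) ≤ closedMass m * m !
closedBound zero {A} {B} A⊆B eq unique within bound with refl ← d≡0⇒≡ A⊆B eq =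
  *-monoʳ-≤ 6 (≤-trans (∑-subsingleton unique (λ g∈ → ⊆-antisym (proj₂ (within g∈)) (proj₁ (within g∈))))
    (≤-reflexive (trans (ω-bottom A A) (cong _! eq))))
closedBound (suc m) {A} {B} {L} A⊆B eq unique within bound = begin
  6 * ∑ L (ω A B) ≡⟨ cong (6 *_) (trans (∑-split (_≟ˢ A) L) (cong (∑ bottom (ω A B) +_) (∑-split (_≟ˢ B) L′))) ⟩
  6 * (∑ bottom (ω A B) + (∑ top (ω A B) + ∑ (interior A B L) (ω A B)))
    ≤⟨ *-monoʳ-≤ 6 (+-mono-≤ bottom≤ (+-monoˡ-≤ _ top≤)) ⟩
  6 * (suc m ! + (suc m ! + ∑ (interior A B L) (ω A B))) ≡⟨ lem (suc m !) _ ⟩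
  12 * suc m ! + 6 * ∑ (interior A B L) (ω A B) ≤⟨ +-monoʳ-≤ (12 * suc m !) bound ⟩
  12 * suc m ! + openMass (suc m) * suc m ! ≡⟨ *-distribʳ-+ (suc m !) 12 (openMass (suc m)) ⟨
  (12 + openMass (suc m)) * suc m ! ≡⟨ cong (_* suc m !) (closedMass≡12+ m) ⟨
  closedMass (suc m) * suc m ! ∎
  where
  open ≤-Reasoning
  lem : ∀ f s → 6 * (f + (f + s)) ≡ 12 * f + 6 * s
  lem = solve-∀
  L′ = filter (∁? (_≟ˢ A)) L
  bottom = filter (_≟ˢ A) L
  top = filter (_≟ˢ B) L′
  bottom≤ : ∑ bottom (ω A B) ≤ suc m !
  bottom≤ = ≤-trans (∑-subsingleton (Unique.filter⁺ (_≟ˢ A) unique) (proj₂ ∘ ∈-filter⁻ (_≟ˢ A) {xs = L}))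
    (≤-reflexive (trans (ω-bottom A B) (cong _! eq)))
  top≤ : ∑ top (ω A B) ≤ suc m !
  top≤ = ≤-trans (∑-subsingleton (Unique.filter⁺ (_≟ˢ B) (Unique.filter⁺ (∁? (_≟ˢ A)) unique))
      (proj₂ ∘ ∈-filter⁻ (_≟ˢ B) {xs = L′}))
    (≤-reflexive (trans (ω-top A B) (cong _! eq)))

-- Removing a unique minimal or maximal member

-- The mass of a member above the atom V is in [A , B] at most m/(m + 1) times its mass in [V , B].
peelAtom : ∀ m {A B V : Subset n} {L} → OpenBound n m → d A B ≡ suc m → Unique L →
  Inside A B L → WeakOrder L → V ∈ L → d A V ≡ 1 → (∀ {g} → g ∈ L → g ≢ V → V ⊂ g) →
  6 * ∑ L (ω A B) ≤ openMass (suc m) * suc m !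
peelAtom m {A} {B} {V} {L} ih eq unique between weak V∈ dAV others = begin
  6 * ∑ L (ω A B) ≡⟨ cong (6 *_) (∑-split (_≟ˢ V) L) ⟩
  6 * (∑ (filter (_≟ˢ V) L) (ω A B) + ∑ L′ (ω A B)) ≡⟨ *-distribˡ-+ 6 (∑ (filter (_≟ˢ V) L) (ω A B)) _ ⟩
  6 * ∑ (filter (_≟ˢ V) L) (ω A B) + 6 * ∑ L′ (ω A B) ≤⟨ +-mono-≤ (*-monoʳ-≤ 6 atom≤) rest≤ ⟩
  6 * m ! + m * (openMass m * m !) ≡⟨ lem m (openMass m) (m !) ⟩
  (6 + m * openMass m) * m ! ≤⟨ *-monoˡ-≤ (m !) (arith m 0<m) ⟩
  (openMass (suc m) * suc m) * m ! ≡⟨ *-assoc (openMass (suc m)) (suc m) (m !) ⟩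
  openMass (suc m) * suc m ! ∎
  where
  open ≤-Reasoning
  L′ = filter (∁? (_≟ˢ V)) L
  A⊆V : A ⊆ V
  A⊆V = proj₁ (proj₁ (between V∈))
  V⊂B : V ⊂ B
  V⊂B = proj₂ (between V∈)
  dVB : d V B ≡ m
  dVB = suc-injective (trans (cong (_+ d V B) (sym dAV)) (trans (d-trans A⊆V (proj₁ V⊂B)) eq))
  0<m : 0 < m
  0<m = subst (0 <_) dVB (d-pos V⊂B)
  lem : ∀ m b f → 6 * f + m * (b * f) ≡ (6 + m * b) * f
  lem = solve-∀
  arith : ∀ m → 0 < m → 6 + m * openMass m ≤ openMass (suc m) * suc m
  arith (suc m) _ = openMass-step m
  atom≤ : ∑ (filter (_≟ˢ V) L) (ω A B) ≤ m !
  atom≤ = ≤-trans (∑-subsingleton (Unique.filter⁺ (_≟ˢ V) unique) (proj₂ ∘ ∈-filter⁻ (_≟ˢ V) {xs = L}))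
    (≤-reflexive (trans (cong₂ (λ x y → x ! * y !) dAV dVB) (+-identityʳ _)))
  above : ∀ {g} → g ∈ L′ → g ∈ L × V ⊂ g
  above g∈ with ∈-filter⁻ (∁? (_≟ˢ V)) {xs = L} g∈
  ... | g∈L , g≢V = g∈L , others g∈L g≢V
  ω≤ : ∀ {g} → g ∈ L′ → ω A B g ≤ m * ω V B g
  ω≤ {g} g∈ with above g∈
  ... | g∈L , V⊂g = begin
    d A g ! * d g B ! ≡⟨ cong (λ k → k ! * d g B !) dAg ⟩
    (suc (d V g) * d V g !) * d g B ! ≡⟨ *-assoc (suc (d V g)) (d V g !) _ ⟩
    suc (d V g) * ω V B g ≤⟨ *-monoˡ-≤ (ω V B g) 1+dVg≤m ⟩
    m * ω V B g ∎
    where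
    g⊂B : g ⊂ B
    g⊂B = proj₂ (between g∈L)
    dAg : d A g ≡ suc (d V g)
    dAg = trans (sym (d-trans A⊆V (proj₁ V⊂g))) (cong (_+ d V g) dAV)
    -- Since `g` is a proper subset of `B`, the bound is `m` and not `suc m`; this gives the factor
    -- m/(m + 1).
    1+dVg≤m : suc (d V g) ≤ m
    1+dVg≤m = begin
      1 + d V g ≤⟨ +-monoˡ-≤ (d V g) (d-pos g⊂B) ⟩
      d g B + d V g ≡⟨ +-comm (d g B) _ ⟩
      d V g + d g B ≡⟨ d-trans (proj₁ V⊂g) (proj₁ g⊂B) ⟩
      d V B ≡⟨ dVB ⟩
      m ∎
  rest≤ : 6 * ∑ L′ (ω A B) ≤ m * (openMass m * m !)
  rest≤ = begin
    6 * ∑ L′ (ω A B) ≤⟨ *-monoʳ-≤ 6 (∑-mono L′ ω≤) ⟩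
    6 * ∑ L′ (λ g → m * ω V B g) ≡⟨ cong (6 *_) (∑-*ˡ L′ m) ⟩
    6 * (m * ∑ L′ (ω V B)) ≡⟨ lem′ m (∑ L′ (ω V B)) ⟩
    m * (6 * ∑ L′ (ω V B)) ≤⟨ *-monoʳ-≤ m (ih (proj₁ V⊂B) dVB (Unique.filter⁺ (∁? (_≟ˢ V)) unique)
      (λ g∈ → proj₂ (above g∈) , proj₂ (between (proj₁ (above g∈)))) (filter-weak (∁? (_≟ˢ V)) weak)) ⟩
    m * (openMass m * m !) ∎
    where
    lem′ : ∀ m s → 6 * (m * s) ≡ m * (6 * s)
    lem′ = solve-∀

-- The dual of `peelAtom` under complementation; transitivity of incomparability is a self-dual
-- condition.
peelCoatom : ∀ m {A B U : Subset n} {L} → OpenBound n m → d A B ≡ suc m → Unique L →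
  Inside A B L → WeakOrder L → U ∈ L → d U B ≡ 1 → (∀ {g} → g ∈ L → g ≢ U → g ⊂ U) →
  6 * ∑ L (ω A B) ≤ openMass (suc m) * suc m !
peelCoatom m {A} {B} {U} {L} ih eq unique between weak U∈ dUB others =
  subst (λ s → 6 * s ≤ _) (∑-ω-∁ A B L) (peelAtom m ih (trans (d-∁ A B) eq)
    (Unique.map⁺ ∁-injective unique) between′ weak′ (∈-map⁺ ∁ U∈) (trans (d-∁ U B) dUB) others′)
  where
  between′ : Inside (∁ B) (∁ A) (map ∁ L)
  between′ g∈ with ∈-map⁻ ∁ g∈
  ... | g , g∈L , refl = p⊂q⇒∁p⊃∁q (proj₂ (between g∈L)) , p⊂q⇒∁p⊃∁q (proj₁ (between g∈L))
  weak′ : WeakOrder (map ∁ L)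
  weak′ x∈ y∈ z∈ x⊈y y⊈x y⊈z z⊈y x⊂z with ∈-map⁻ ∁ x∈ | ∈-map⁻ ∁ y∈ | ∈-map⁻ ∁ z∈
  ... | x , x∈L , refl | y , y∈L , refl | z , z∈L , refl =
    weak z∈L y∈L x∈L (λ s → y⊈z (p⊆q⇒∁p⊇∁q s)) (λ s → z⊈y (p⊆q⇒∁p⊇∁q s))
      (λ s → x⊈y (p⊆q⇒∁p⊇∁q s)) (λ s → y⊈x (p⊆q⇒∁p⊇∁q s)) (∁p⊂∁q⇒p⊃q x⊂z)
  others′ : ∀ {g} → g ∈ map ∁ L → g ≢ ∁ U → ∁ U ⊂ g
  others′ g∈ g≢ with ∈-map⁻ ∁ g∈
  ... | g , g∈L , refl = p⊂q⇒∁p⊃∁q (others g∈L (λ { refl → g≢ refl }))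

-- Subintervals and the sum of the levels

-- Choosing chains of [V , U] inside those of [A , B]: C(t , s) C(v + w , v) ≤ C(v + t + w , v + s).
ω-subinterval : ∀ {A V g U B : Subset n} → A ⊆ V → V ⊆ g → g ⊆ U → U ⊆ B →
  binom (d A V) (d U B) * d V U ! * ω A B g ≤ d A B ! * ω V U g
ω-subinterval {A = A} {V} {g} {U} {B} A⊆V V⊆g g⊆U U⊆B = begin
  binom v w * d V U ! * ω A B g
    ≡⟨ cong (λ x → binom v w * x * ω A B g) (trans (cong _! (sym (d-trans V⊆g g⊆U))) (sym (binom-! s r))) ⟩
  binom v w * (binom s r * (s ! * r !)) * ω A B g ≡⟨ lem (binom v w) (binom s r) (s ! * r !) (ω A B g) ⟩
  (binom s r * binom v w) * (ω A B g * (s ! * r !)) ≤⟨ *-monoˡ-≤ _ (binom-* s r v w) ⟩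
  binom (s + v) (r + w) * (ω A B g * (s ! * r !)) ≡⟨ *-assoc (binom (s + v) (r + w)) (ω A B g) _ ⟨
  (binom (s + v) (r + w) * ω A B g) * (s ! * r !) ≡⟨ cong (_* (s ! * r !)) whole ⟩
  d A B ! * ω V U g ∎
  where
  open ≤-Reasoning
  v = d A V
  w = d U B
  s = d V g
  r = d g U
  lem : ∀ D C f o → D * (C * f) * o ≡ (C * D) * (o * f)
  lem = solve-∀
  dAg : d A g ≡ s + v
  dAg = trans (sym (d-trans A⊆V V⊆g)) (+-comm v s)
  dgB : d g B ≡ r + w
  dgB = sym (d-trans g⊆U U⊆B)
  whole : binom (s + v) (r + w) * ω A B g ≡ d A B !
  whole = trans (cong₂ (λ x y → binom (s + v) (r + w) * (x ! * y !)) dAg dgB)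
    (trans (binom-! (s + v) (r + w)) (cong _! (trans (cong₂ _+_ (sym dAg) (sym dgB))
      (d-trans (V⊆g ∘ A⊆V) (U⊆B ∘ g⊆U)))))

-- Summing `ω-subinterval` and cancelling `t !` shows that passing from [V , U] to [A , B] divides
-- the mass by at least the binomial factor.
∑-subinterval : ∀ {A V U B : Subset n} {L} → A ⊆ V → U ⊆ B → Within V U L →
  6 * ∑ L (ω V U) ≤ closedMass (d V U) * d V U ! →
  binom (d A V) (d U B) * (6 * ∑ L (ω A B)) ≤ closedMass (d V U) * d A B !
∑-subinterval {A = A} {V} {U} {B} {L} A⊆V U⊆B within bound = *-cancelˡ-≤ (t !) {{t !≢0}} (begin
  t ! * (D * (6 * ∑ L (ω A B))) ≡⟨ lem₁ (t !) D (∑ L (ω A B)) ⟩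
  6 * (D * t ! * ∑ L (ω A B)) ≡⟨ cong (6 *_) (∑-*ˡ L (D * t !)) ⟨
  6 * ∑ L (λ g → D * t ! * ω A B g)
    ≤⟨ *-monoʳ-≤ 6 (∑-mono L λ g∈ → ω-subinterval A⊆V (proj₁ (within g∈)) (proj₂ (within g∈)) U⊆B) ⟩
  6 * ∑ L (λ g → d A B ! * ω V U g) ≡⟨ cong (6 *_) (∑-*ˡ L (d A B !)) ⟩
  6 * (d A B ! * ∑ L (ω V U)) ≡⟨ lem₂ (d A B !) (∑ L (ω V U)) ⟩
  d A B ! * (6 * ∑ L (ω V U)) ≤⟨ *-monoʳ-≤ (d A B !) bound ⟩
  d A B ! * (closedMass t * t !) ≡⟨ lem₃ (d A B !) (closedMass t) (t !) ⟩
  t ! * (closedMass t * d A B !) ∎)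
  where
  open ≤-Reasoning
  t = d V U
  D = binom (d A V) (d U B)
  lem₁ : ∀ f D s → f * (D * (6 * s)) ≡ 6 * (D * f * s)
  lem₁ = solve-∀
  lem₂ : ∀ f s → 6 * (f * s) ≡ f * (6 * s)
  lem₂ = solve-∀
  lem₃ : ∀ f c g → f * (c * g) ≡ g * (c * f)
  lem₃ = solve-∀

-- The minimal and maximal levels contribute at most (v + w)/m, the inner ones at most t/m + 1/6.
combineLevels : ∀ i j t m {inner low high} → (2 + i) + t + (2 + j) ≡ suc m →
  low ≤ (2 + i) * m ! → high ≤ (2 + j) * m ! →
  binom (2 + i) (2 + j) * (6 * inner) ≤ closedMass t * suc m ! →
  6 * (inner + high + low) ≤ 7 * suc m !
combineLevels i j t m {inner} {low} {high} m≡ low≤ high≤ inner≤ = begin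
  6 * (inner + high + low) ≡⟨ lem₁ inner high low ⟩
  6 * inner + 6 * high + 6 * low ≤⟨ +-mono-≤ (+-mono-≤ inner≤′ (*-monoʳ-≤ 6 high≤)) (*-monoʳ-≤ 6 low≤) ⟩
  (suc m + 6 * t) * m ! + 6 * ((2 + j) * m !) + 6 * ((2 + i) * m !) ≡⟨ lem₂ (suc m) i j t (m !) ⟩
  -- The three dimensions add up to `suc m`, so the three fractions sum to 1, and the extra 1/6
  -- makes 7/6.
  (suc m + 6 * ((2 + i) + t + (2 + j))) * m ! ≡⟨ cong (λ k → (suc m + 6 * k) * m !) m≡ ⟩
  (suc m + 6 * suc m) * m ! ≡⟨ lem₃ (suc m) (m !) ⟩
  7 * (suc m * m !) ∎
  where
  open ≤-Reasoning
  D = binom (2 + i) (2 + j)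
  D≢0 : NonZero D
  D≢0 = >-nonZero (≤-trans (s≤s z≤n) (binom-linear i j))
  lem₁ : ∀ a b c → 6 * (a + b + c) ≡ 6 * a + 6 * b + 6 * c
  lem₁ = solve-∀
  lem₂ : ∀ m i j t f → (m + 6 * t) * f + 6 * ((2 + j) * f) + 6 * ((2 + i) * f) ≡ (m + 6 * ((2 + i) + t + (2 + j))) * f
  lem₂ = solve-∀
  lem₃ : ∀ m f → (m + 6 * m) * f ≡ 7 * (m * f)
  lem₃ = solve-∀
  lem₄ : ∀ D m s → D * (m * s) ≡ m * (D * s)
  lem₄ = solve-∀
  lem₅ : ∀ m t D f → (m + 6 * t) * D * (m * f) ≡ D * (m * ((m + 6 * t) * f))
  lem₅ = solve-∀
  -- After multiplication by `D` and `suc m`, `closedMass-binom` replaces the subinterval bound by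
  -- t/(m + 1) + 1/6.
  inner≤′ : 6 * inner ≤ (suc m + 6 * t) * m !
  inner≤′ = *-cancelˡ-≤ (suc m) (*-cancelˡ-≤ D {{D≢0}} (begin
    D * (suc m * (6 * inner)) ≡⟨ lem₄ D (suc m) (6 * inner) ⟩
    suc m * (D * (6 * inner)) ≤⟨ *-monoʳ-≤ (suc m) inner≤ ⟩
    suc m * (closedMass t * suc m !) ≡⟨ *-assoc (suc m) (closedMass t) _ ⟨
    suc m * closedMass t * suc m !
      ≤⟨ *-monoˡ-≤ (suc m !) (subst (λ k → k * closedMass t ≤ (k + 6 * t) * D) m≡ (closedMass-binom i j t)) ⟩
    (suc m + 6 * t) * D * suc m ! ≡⟨ lem₅ (suc m) t D (m !) ⟩
    D * (suc m * ((suc m + 6 * t) * m !)) ∎))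

-- Minimal and maximal members

HasBelow HasAbove : Family n → Subset n → Set
HasBelow L g = Any (_⊂ g) L
HasAbove L g = Any (g ⊂_) L

hasBelow? : (L : Family n) → Decidable (HasBelow L)
hasBelow? L g = any? (_⊂? g) L

hasAbove? : (L : Family n) → Decidable (HasAbove L)
hasAbove? L g = any? (g ⊂?_) L

-- Descent to strictly smaller members; `k` exceeds the cardinality of the current set, so it cannot
-- run out. `maximalAbove` measures by the complement instead.
minimalBelow : ∀ (L : Family n) {g} → g ∈ L → ∃[ y ] (y ∈ L × ¬ HasBelow L y × y ⊆ g)
minimalBelow {n} L {g} = go (suc ∣ g ∣) g ≤-refl
  where
  go : ∀ k (g : Subset n) → ∣ g ∣ < k → g ∈ L → ∃[ y ] (y ∈ L × ¬ HasBelow L y × y ⊆ g)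
  go (suc k) g (s≤s ∣g∣≤k) g∈ with hasBelow? L g
  ... | no minimal = g , g∈ , minimal , id
  ... | yes below with find below
  ... | h , h∈ , h⊂g with go k h (<-≤-trans (p⊂q⇒∣p∣<∣q∣ h⊂g) ∣g∣≤k) h∈
  ... | y , y∈ , minimal , y⊆h = y , y∈ , minimal , proj₁ h⊂g ∘ y⊆h

maximalAbove : ∀ (L : Family n) {g} → g ∈ L → ∃[ z ] (z ∈ L × ¬ HasAbove L z × g ⊆ z)
maximalAbove {n} L {g} = go (suc ∣ ∁ g ∣) g ≤-refl
  where
  go : ∀ k (g : Subset n) → ∣ ∁ g ∣ < k → g ∈ L → ∃[ z ] (z ∈ L × ¬ HasAbove L z × g ⊆ z)
  go (suc k) g (s≤s ∣∁g∣≤k) g∈ with hasAbove? L g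
  ... | no maximal = g , g∈ , maximal , id
  ... | yes above with find above
  ... | h , h∈ , g⊂h with go k h (<-≤-trans (p⊂q⇒∣p∣<∣q∣ (p⊂q⇒∁p⊃∁q g⊂h)) ∣∁g∣≤k) h∈
  ... | z , z∈ , maximal , h⊆z = z , z∈ , maximal , h⊆z ∘ proj₁ g⊂h

module _ {L : Family n} (weak : WeakOrder L) where

  -- Let `x` be a member below `g`. If `y` and `g` were incomparable, then so would be `x` and `y`:
  -- `x ⊂ y` contradicts minimality and `y ⊆ x` gives `y ⊆ g`. Transitivity then contradicts
  -- `x ⊂ g`.
  minimal⊂ : ∀ {y g} → y ∈ L → g ∈ L → ¬ HasBelow L y → HasBelow L g → y ⊂ g
  minimal⊂ {y} {g} y∈ g∈ minimal below with find below
  ... | x , x∈ , x⊂g with y ⊆? g | g ⊆? y | x ⊆? y | y ⊆? x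
  ... | yes y⊆g | _ | _ | _ = ⊆∧≢⇒⊂ y⊆g λ { refl → minimal below }
  ... | no _ | yes g⊆y | _ | _ = ⊥-elim (minimal (lose x∈ (⊂-⊆-trans x⊂g g⊆y)))
  ... | no y⊈g | no _ | _ | yes y⊆x = ⊥-elim (y⊈g (proj₁ x⊂g ∘ y⊆x))
  ... | no _ | no _ | yes x⊆y | no y⊈x = ⊥-elim (minimal (lose x∈ (⊆∧⊉⇒⊂ x⊆y y⊈x)))
  ... | no y⊈g | no g⊈y | no x⊈y | no y⊈x = ⊥-elim (weak x∈ y∈ g∈ x⊈y y⊈x y⊈g g⊈y x⊂g)

  ⊂maximal : ∀ {z g} → z ∈ L → g ∈ L → ¬ HasAbove L z → HasAbove L g → g ⊂ z
  ⊂maximal {z} {g} z∈ g∈ maximal above with find above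
  ... | x , x∈ , g⊂x with g ⊆? z | z ⊆? g | z ⊆? x | x ⊆? z
  ... | yes g⊆z | _ | _ | _ = ⊆∧≢⇒⊂ g⊆z λ { refl → maximal above }
  ... | no _ | yes z⊆g | _ | _ = ⊥-elim (maximal (lose x∈ (⊆-⊂-trans z⊆g g⊂x)))
  ... | no g⊈z | no _ | _ | yes x⊆z = ⊥-elim (g⊈z (x⊆z ∘ proj₁ g⊂x))
  ... | no _ | no _ | yes z⊆x | no x⊈z = ⊥-elim (maximal (lose x∈ (⊆∧⊉⇒⊂ z⊆x x⊈z)))
  ... | no g⊈z | no z⊈g | no z⊈x | no x⊈z = ⊥-elim (weak g∈ z∈ x∈ g⊈z z⊈g z⊈x x⊈z g⊂x)

-- Unions and intersections of families

⋃-upper : ∀ (A : Subset n) {L g} → g ∈ L → g ⊆ foldr _∪_ A L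
⋃-upper A {g ∷ L} (here refl) = p⊆p∪q (foldr _∪_ A L)
⋃-upper A {h ∷ L} (there g∈) = q⊆p∪q h (foldr _∪_ A L) ∘ ⋃-upper A g∈

⋃-base : ∀ (A : Subset n) L → A ⊆ foldr _∪_ A L
⋃-base A [] = id
⋃-base A (h ∷ L) = q⊆p∪q h (foldr _∪_ A L) ∘ ⋃-base A L

⋃-least : ∀ {A B : Subset n} L → A ⊆ B → (∀ {g} → g ∈ L → g ⊆ B) → foldr _∪_ A L ⊆ B
⋃-least [] A⊆B _ = A⊆B
⋃-least {A = A} (h ∷ L) A⊆B all x∈ with x∈p∪q⁻ h (foldr _∪_ A L) x∈
... | inj₁ x∈h = all (here refl) x∈h
... | inj₂ x∈L = ⋃-least L A⊆B (λ g∈ → all (there g∈)) x∈L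

⋂-lower : ∀ (B : Subset n) {L g} → g ∈ L → foldr _∩_ B L ⊆ g
⋂-lower B {g ∷ L} (here refl) = p∩q⊆p g (foldr _∩_ B L)
⋂-lower B {h ∷ L} (there g∈) = ⋂-lower B g∈ ∘ p∩q⊆q h (foldr _∩_ B L)

⋂-base : ∀ (B : Subset n) L → foldr _∩_ B L ⊆ B
⋂-base B [] = id
⋂-base B (h ∷ L) = ⋂-base B L ∘ p∩q⊆q h (foldr _∩_ B L)

⋂-greatest : ∀ {A B : Subset n} L → A ⊆ B → (∀ {g} → g ∈ L → A ⊆ g) → A ⊆ foldr _∩_ B L
⋂-greatest [] A⊆B _ = A⊆B
⋂-greatest (h ∷ L) A⊆B all x∈ = x∈p∩q⁺ (all (here refl) x∈ , ⋂-greatest L A⊆B (λ g∈ → all (there g∈)) x∈)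

d≡1⇒≡ : ∀ {A g V : Subset n} → A ⊂ g → g ⊆ V → d A V ≡ 1 → g ≡ V
d≡1⇒≡ {A = A} {g} {V} A⊂g g⊆V eq = d≡0⇒≡ g⊆V (n≤0⇒n≡0 (+-cancelˡ-≤ 1 _ _ (begin
  1 + d g V ≤⟨ +-monoˡ-≤ (d g V) (d-pos A⊂g) ⟩
  d A g + d g V ≡⟨ d-trans (proj₁ A⊂g) g⊆V ⟩
  d A V ≡⟨ eq ⟩
  1 ∎)))
  where open ≤-Reasoning

d≡1⇒≡′ : ∀ {U g B : Subset n} → g ⊂ B → U ⊆ g → d U B ≡ 1 → U ≡ g
d≡1⇒≡′ {U = U} {g} {B} g⊂B U⊆g eq = d≡0⇒≡ U⊆g (n≤0⇒n≡0 (+-cancelʳ-≤ 1 _ _ (begin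
  d U g + 1 ≤⟨ +-monoʳ-≤ (d U g) (d-pos g⊂B) ⟩
  d U g + d g B ≡⟨ d-trans U⊆g (proj₁ g⊂B) ⟩
  d U B ≡⟨ eq ⟩
  1 ∎)))
  where open ≤-Reasoning

-- Level decomposition of a weak order with two comparable members

module Levels {A B : Subset n} {L : Family n} (A⊆B : A ⊆ B) (unique : Unique L) (between : Inside A B L)
  (weak : WeakOrder L) {x y : Subset n} (x∈ : x ∈ L) (y∈ : y ∈ L) (x⊂y : x ⊂ y) where

  -- Taking `high` and `inner` from `rest` keeps the three levels disjoint, so two uses of `∑-split`
  -- recover the whole sum.
  low rest high inner : Family n
  low = filter (∁? (hasBelow? L)) L
  rest = filter (hasBelow? L) L
  high = filter (∁? (hasAbove? L)) rest
  inner = filter (hasAbove? L) rest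

  -- The folds start at `A` and `B`, so `A ⊆ V` and `U ⊆ B` hold by construction.
  V U : Subset n
  V = foldr _∪_ A low
  U = foldr _∩_ B high

  low⁻ : ∀ {g} → g ∈ low → g ∈ L × ¬ HasBelow L g
  low⁻ = ∈-filter⁻ (∁? (hasBelow? L)) {xs = L}

  rest⁻ : ∀ {g} → g ∈ rest → g ∈ L × HasBelow L g
  rest⁻ = ∈-filter⁻ (hasBelow? L) {xs = L}

  high⁻ : ∀ {g} → g ∈ high → g ∈ rest × ¬ HasAbove L g
  high⁻ = ∈-filter⁻ (∁? (hasAbove? L)) {xs = rest}

  inner⁻ : ∀ {g} → g ∈ inner → g ∈ rest × HasAbove L g
  inner⁻ = ∈-filter⁻ (hasAbove? L) {xs = rest}

  A⊆V : A ⊆ V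
  A⊆V = ⋃-base A low

  U⊆B : U ⊆ B
  U⊆B = ⋂-base B high

  V⊆rest : ∀ {g} → g ∈ rest → V ⊆ g
  V⊆rest g∈ = ⋃-least low (proj₁ (proj₁ (between (proj₁ (rest⁻ g∈)))))
    (λ h∈ → proj₁ (minimal⊂ weak (proj₁ (low⁻ h∈)) (proj₁ (rest⁻ g∈)) (proj₂ (low⁻ h∈)) (proj₂ (rest⁻ g∈))))

  nonmaximal⊆U : ∀ {g} → g ∈ L → HasAbove L g → g ⊆ U
  nonmaximal⊆U g∈ above = ⋂-greatest high (proj₁ (proj₂ (between g∈)))
    (λ z∈ → proj₁ (⊂maximal weak (proj₁ (rest⁻ (proj₁ (high⁻ z∈)))) g∈ (proj₂ (high⁻ z∈)) above))

  V⊆B : V ⊆ B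
  V⊆B = ⋃-least low A⊆B (λ g∈ → proj₁ (proj₂ (between (proj₁ (low⁻ g∈)))))

  V⊆U : V ⊆ U
  V⊆U = ⋂-greatest high V⊆B (λ z∈ → V⊆rest (proj₁ (high⁻ z∈)))

  minimal : ∃[ g ] (g ∈ low)
  minimal with minimalBelow L x∈
  ... | g , g∈ , g-min , _ = g , ∈-filter⁺ (∁? (hasBelow? L)) g∈ g-min

  -- No member is both minimal and maximal: `y` has `x` below it, so `minimal⊂` would put such a
  -- member strictly below `y`.
  maximal⇒high : ∀ {g} → g ∈ L → ¬ HasAbove L g → g ∈ high
  maximal⇒high {g} g∈ g-max = ∈-filter⁺ (∁? (hasAbove? L)) (∈-filter⁺ (hasBelow? L) g∈ below) g-max
    where
    below : HasBelow L g
    below with hasBelow? L g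
    ... | yes below = below
    ... | no g-min = ⊥-elim (g-max (lose y∈ (minimal⊂ weak g∈ y∈ g-min (lose x∈ x⊂y))))

  maximal : ∃[ g ] (g ∈ high)
  maximal with maximalAbove L y∈
  ... | g , g∈ , g-max , _ = g , maximal⇒high g∈ g-max

  A⊂low : ∀ {g} → g ∈ low → A ⊂ g × g ⊆ V
  A⊂low g∈ = proj₁ (between (proj₁ (low⁻ g∈))) , ⋃-upper A g∈

  high⊂B : ∀ {g} → g ∈ high → U ⊆ g × g ⊂ B
  high⊂B g∈ = ⋂-lower B g∈ , proj₂ (between (proj₁ (rest⁻ (proj₁ (high⁻ g∈)))))

  A⊂V : A ⊂ V
  A⊂V with minimal
  ... | g , g∈ = ⊂-⊆-trans (proj₁ (A⊂low g∈)) (proj₂ (A⊂low g∈))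

  U⊂B : U ⊂ B
  U⊂B with maximal
  ... | g , g∈ = ⊆-⊂-trans (proj₁ (high⊂B g∈)) (proj₂ (high⊂B g∈))

  inner-within : Within V U inner
  inner-within g∈ = V⊆rest (proj₁ (inner⁻ g∈)) ,
    nonmaximal⊆U (proj₁ (rest⁻ (proj₁ (inner⁻ g∈)))) (proj₂ (inner⁻ g∈))

  low-antichain : Antichain low
  low-antichain {g} {h} g∈ h∈ g⊆h with g ≟ˢ h
  ... | yes g≡h = g≡h
  ... | no g≢h = ⊥-elim (proj₂ (low⁻ h∈) (lose (proj₁ (low⁻ g∈)) (⊆∧≢⇒⊂ g⊆h g≢h)))

  high-antichain : Antichain high
  high-antichain {g} {h} g∈ h∈ g⊆h with g ≟ˢ h
  ... | yes g≡h = g≡h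
  ... | no g≢h = ⊥-elim (proj₂ (high⁻ g∈) (lose (proj₁ (rest⁻ (proj₁ (high⁻ h∈)))) (⊆∧≢⇒⊂ g⊆h g≢h)))

  -- A minimal member lies strictly above `A` and inside `V`, hence equals `V` when `V` is one step
  -- from `A`. So `V` is the only minimal member and lies below all others.
  atom : d A V ≡ 1 → V ∈ L × (∀ {g} → g ∈ L → g ≢ V → V ⊂ g)
  atom dAV with minimal
  ... | g , g∈ with refl ← d≡1⇒≡ (proj₁ (A⊂low g∈)) (proj₂ (A⊂low g∈)) dAV =
    proj₁ (low⁻ g∈) , others
    where
    others : ∀ {h} → h ∈ L → h ≢ V → V ⊂ h
    others {h} h∈ h≢V with hasBelow? L h
    ... | yes below = minimal⊂ weak (proj₁ (low⁻ g∈)) h∈ (proj₂ (low⁻ g∈)) below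
    ... | no h-min = contradiction (d≡1⇒≡ (proj₁ (A⊂low h∈low)) (proj₂ (A⊂low h∈low)) dAV) h≢V
      where
      h∈low : h ∈ low
      h∈low = ∈-filter⁺ (∁? (hasBelow? L)) h∈ h-min

  coatom : d U B ≡ 1 → U ∈ L × (∀ {g} → g ∈ L → g ≢ U → g ⊂ U)
  coatom dUB with maximal
  ... | g , g∈ = subst (_∈ L) (sym U≡g) g∈L , others
    where
    g∈L : g ∈ L
    g∈L = proj₁ (rest⁻ (proj₁ (high⁻ g∈)))
    U≡g : U ≡ g
    U≡g = d≡1⇒≡′ (proj₂ (high⊂B g∈)) (proj₁ (high⊂B g∈)) dUB
    others : ∀ {h} → h ∈ L → h ≢ U → h ⊂ U
    others {h} h∈ h≢U with hasAbove? L h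
    ... | yes above = subst (h ⊂_) (sym U≡g) (⊂maximal weak g∈L h∈ (proj₂ (high⁻ g∈)) above)
    ... | no h-max = contradiction (sym (d≡1⇒≡′ (proj₂ (high⊂B h∈high)) (proj₁ (high⊂B h∈high)) dUB)) h≢U
      where
      h∈high : h ∈ high
      h∈high = maximal⇒high h∈ h-max

  m≡ : d A V + d V U + d U B ≡ d A B
  m≡ = trans (cong (_+ d U B) (d-trans A⊆V V⊆U)) (d-trans (V⊆U ∘ A⊆V) U⊆B)

  bound : ∀ {m} → d A B ≡ suc m → (∀ {t} → t < suc m → OpenBound n t) → 6 * ∑ L (ω A B) ≤ openMass (suc m) * suc m !
  bound {m} dAB rec with d A V in dAV | d U B in dUB | d-pos A⊂V | d-pos U⊂B
  ... | 1 | _ | _ | _ = peelAtom m (rec ≤-refl) dAB unique between weak (proj₁ (atom dAV)) dAV (proj₂ (atom dAV))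
  ... | suc (suc _) | 1 | _ | _ =
    peelCoatom m (rec ≤-refl) dAB unique between weak (proj₁ (coatom dUB)) dUB (proj₂ (coatom dUB))
  -- Both outer dimensions are at least 2, so the total is at least 4 and `openMass` has its value
  -- 7.
  ... | suc (suc i) | suc (suc j) | _ | _ = subst₂ _≤_ (cong (6 *_) (sym split)) (cong (_* suc m !) 7≡)
    (combineLevels i j t m {∑ inner (ω A B)} size
      (subst (λ k → ∑ low (ω A B) ≤ k * m !) dAV
        (∑-below m (Unique.filter⁺ (∁? (hasBelow? L)) unique) low-antichain A⊂low A⊆V (U⊆B ∘ V⊆U) dAB))
      (subst (λ k → ∑ high (ω A B) ≤ k * m !) dUB
        (∑-above m (Unique.filter⁺ (∁? (hasAbove? L)) rest-unique) high-antichain high⊂B (V⊆U ∘ A⊆V) U⊆B dAB))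
      inner≤)
    where
    t = d V U
    size : (2 + i) + t + (2 + j) ≡ suc m
    size = trans (cong₂ (λ v w → v + t + w) (sym dAV) (sym dUB)) (trans m≡ dAB)
    rest-unique : Unique rest
    rest-unique = Unique.filter⁺ (hasBelow? L) unique
    inner-unique : Unique inner
    inner-unique = Unique.filter⁺ (hasAbove? L) rest-unique
    split : ∑ L (ω A B) ≡ ∑ inner (ω A B) + ∑ high (ω A B) + ∑ low (ω A B)
    split = trans (∑-split (hasBelow? L) L) (cong (_+ ∑ low (ω A B)) (∑-split (hasAbove? L) rest))
    7≡ : 7 ≡ openMass (suc m)
    7≡ = trans (sym (lem i j t)) (cong openMass size)
      where
      lem : ∀ i j t → openMass ((2 + i) + t + (2 + j)) ≡ 7
      lem i j t = cong openMass (lem′ i j t)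
        where
        lem′ : ∀ i j t → (2 + i) + t + (2 + j) ≡ 3 + (1 + i + j + t)
        lem′ = solve-∀
    t<m : t < suc m
    t<m = subst (t <_) size (≤-trans (m≤m+n (suc t) (3 + i + j)) (≤-reflexive (lem i j t)))
      where
      lem : ∀ i j t → suc t + (3 + i + j) ≡ (2 + i) + t + (2 + j)
      lem = solve-∀
    inner≤ : binom (2 + i) (2 + j) * (6 * ∑ inner (ω A B)) ≤ closedMass t * suc m !
    inner≤ = subst₂ _≤_ (cong₂ (λ v w → binom v w * (6 * ∑ inner (ω A B))) dAV dUB) (cong (λ k → closedMass t * k !) dAB)
      -- The inner members may include `V` and `U`, so the recursion bounds those strictly between
      -- them and `closedBound` adds the ends.
      (∑-subinterval A⊆V U⊆B inner-within (closedBound t V⊆U refl inner-unique inner-within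
        (rec t<m V⊆U refl
          (Unique.filter⁺ (∁? (_≟ˢ U)) (Unique.filter⁺ (∁? (_≟ˢ V)) inner-unique))
          (interior-inside {L = inner} inner-within)
          (filter-weak (∁? (_≟ˢ U)) (filter-weak (∁? (_≟ˢ V)) (filter-weak (hasAbove? L) (filter-weak (hasBelow? L) weak)))))))

-- An antichain has mass at most 1 by `LYM`, and a nonempty one forces dimension at least 2.
-- Otherwise two comparable members start the level decomposition.
openBound : ∀ m → OpenBound n m
openBound {n} = <-rec (OpenBound n) step
  where
  step : ∀ m → (∀ {t} → t < m → OpenBound n t) → OpenBound n m
  step m rec {L = []} A⊆B dAB unique between weak = z≤n
  step m rec {A} {B} {L@(g ∷ _)} A⊆B dAB unique between weak with any? (hasAbove? L) L
  ... | no anti = *-mono-≤ (6≤ m 2≤m) (LYM m unique antichain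
      (λ g∈ → proj₁ (proj₁ (between g∈)) , proj₁ (proj₂ (between g∈))) A⊆B dAB)
    where
    antichain : Antichain L
    antichain {g} {h} g∈ h∈ g⊆h with g ≟ˢ h
    ... | yes g≡h = g≡h
    ... | no g≢h = ⊥-elim (anti (lose g∈ (lose h∈ (⊆∧≢⇒⊂ g⊆h g≢h))))
    2≤m : 2 ≤ m
    2≤m with between (here refl)
    ... | A⊂g , g⊂B = subst (2 ≤_) (trans (d-trans (proj₁ A⊂g) (proj₁ g⊂B)) dAB) (+-mono-≤ (d-pos A⊂g) (d-pos g⊂B))
    6≤ : ∀ m → 2 ≤ m → 6 ≤ openMass m
    6≤ (suc (suc m)) _ = 6≤openMass m
    6≤ 1 (s≤s ())
  ... | yes chain with find chain
  ... | x , x∈ , above with find above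
  ... | y , y∈ , x⊂y with m
  ... | zero = contradiction (subst (0 <_) dAB (d-pos (⊂-trans (proj₁ (between x∈)) (proj₂ (between x∈))))) λ ()
  ... | suc m′ = Levels.bound A⊆B unique between weak x∈ y∈ x⊂y dAB rec

-- From colorings to the Lubell mass

-- All that the upper bound retains of the coloring. It passes to subfamilies and to families of
-- complements, as the induction on intervals requires.
LocallyWeak : Family n → Set
LocallyWeak L = ∀ {A B x y z} → A ∈ L → B ∈ L → x ∈ L → y ∈ L → z ∈ L →
  A ⊂ x × x ⊂ B → A ⊂ y × y ⊂ B → A ⊂ z × z ⊂ B →
  ¬ (x ⊆ y) → ¬ (y ⊆ x) → ¬ (y ⊆ z) → ¬ (z ⊆ y) → ¬ (x ⊂ z)

-- Incomparable members of an open interval between members of 𝓕 get the same colour, while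
-- comparable ones do not.
good⇒locallyWeak : ∀ (𝓕 : Family n) → Good n 𝓕 → LocallyWeak 𝓕
good⇒locallyWeak 𝓕 (_ , col , proper , noRainbow) {A} {B} {x} {y} {z} A∈ B∈ x∈ y∈ z∈
  A<x<B A<y<B A<z<B x⊈y y⊈x y⊈z z⊈y x⊂z =
  proper x z x∈ z∈ x⊂z (trans (same x∈ y∈ A<x<B A<y<B x⊈y y⊈x) (same y∈ z∈ A<y<B A<z<B y⊈z z⊈y))
  where
  same : ∀ {g h} → g ∈ 𝓕 → h ∈ 𝓕 → A ⊂ g × g ⊂ B → A ⊂ h × h ⊂ B → ¬ (g ⊆ h) → ¬ (h ⊆ g) → col g ≡ col h
  same {g} {h} g∈ h∈ (A⊂g , g⊂B) (A⊂h , h⊂B) g⊈h h⊈g with col g ≟ col h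
  ... | yes eq = eq
  ... | no g≢h = ⊥-elim (noRainbow A g h B (A∈ , g∈ , h∈ , B∈ , A⊂g , g⊂B , A⊂h , h⊂B , g⊈h , h⊈g)
    (proper A g A∈ g∈ A⊂g , proper A h A∈ h∈ A⊂h , proper A B A∈ B∈ (⊂-trans A⊂g g⊂B) ,
      g≢h , proper g B g∈ B∈ g⊂B , proper h B h∈ B∈ h⊂B))

-- There are `m !` maximal chains, and 19/6 is 3 + 1/6.
LubellBound : ℕ → ℕ → Set
LubellBound n m = ∀ {A B : Subset n} {L} → A ⊆ B → d A B ≡ m → Unique L → LocallyWeak L → Within A B L →
  6 * ∑ L (ω A B) ≤ 19 * m !

-- With `A` absent, every member is met after the first step, so the mass is an average of masses in
-- intervals of dimension `m`.
lubellBound-∉ : ∀ m → LubellBound n m → ∀ {A B : Subset n} {L} → A ⊆ B → d A B ≡ suc m →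
  Unique L → LocallyWeak L → Within A B L → A ∉ L → 6 * ∑ L (ω A B) ≤ 19 * suc m !
lubellBound-∉ m ih {A} {B} {L} A⊆B dAB unique weak within A∉L = begin
  6 * ∑ L (ω A B) ≤⟨ ∑-step {B = B} {U = B} {c = 6} (λ g∈ → ⊆∧≢⇒⊂ (proj₁ (within g∈)) (λ { refl → A∉L g∈ }) , proj₂ (within g∈)) bound ⟩
  d A B * (19 * m !) ≡⟨ cong (_* (19 * m !)) dAB ⟩
  suc m * (19 * m !) ≡⟨ lem (suc m) (m !) ⟩
  19 * suc m ! ∎
  where
  open ≤-Reasoning
  lem : ∀ m f → m * (19 * f) ≡ 19 * (m * f)
  lem = solve-∀
  bound : ∀ a → a ∈ˢ B ─ A → 6 * ∑ (filter (a ∈?_) L) (ω (A ∪ ⁅ a ⁆) B) ≤ 19 * m !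
  bound a a∈ = ih (insert-⊆ A⊆B (p─q⊆p B A a∈)) (d-step A⊆B (p─q⊆p B A a∈) (x∈p─q⇒x∉q B A a∈) dAB)
    (Unique.filter⁺ (a ∈?_) unique)
    (λ A∈ B∈ x∈ y∈ z∈ → weak (sub A∈) (sub B∈) (sub x∈) (sub y∈) (sub z∈))
    (filter-within {L = L} within)
    where
    sub : ∀ {g} → g ∈ filter (a ∈?_) L → g ∈ L
    sub = proj₁ ∘ ∈-filter⁻ (a ∈?_) {xs = L}

lubellBound : ∀ m → LubellBound n m
lubellBound zero {A} {B} {L} A⊆B dAB unique weak within with refl ← d≡0⇒≡ A⊆B dAB =
  *-mono-≤ {6} {19} (m≤n+m 6 13)
    (≤-trans (∑-subsingleton unique (λ g∈ → ⊆-antisym (proj₂ (within g∈)) (proj₁ (within g∈))))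
      (≤-reflexive (trans (ω-bottom A A) (cong _! dAB))))
lubellBound {n} (suc m) {A} {B} {L} A⊆B dAB unique weak within with any? (A ≟ˢ_) L | any? (B ≟ˢ_) L
... | no A∉L | _ = lubellBound-∉ m (lubellBound m) A⊆B dAB unique weak within A∉L
-- Complementation turns the missing top into a missing bottom.
... | yes _ | no B∉L = subst (λ s → 6 * s ≤ _) (∑-ω-∁ A B L)
  (lubellBound-∉ m (lubellBound m) (p⊆q⇒∁p⊇∁q A⊆B) (trans (d-∁ A B) dAB) (Unique.map⁺ ∁-injective unique)
    weak′ within′ ∁B∉)
  where
  between : ∀ {A B g : Subset n} → ∁ A ⊂ ∁ g × ∁ g ⊂ ∁ B → B ⊂ g × g ⊂ A
  between (A<g , g<B) = ∁p⊂∁q⇒p⊃q g<B , ∁p⊂∁q⇒p⊃q A<g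
  weak′ : LocallyWeak (map ∁ L)
  weak′ A∈ B∈ x∈ y∈ z∈ A<x<B A<y<B A<z<B x⊈y y⊈x y⊈z z⊈y x⊂z
    with ∈-map⁻ ∁ A∈ | ∈-map⁻ ∁ B∈ | ∈-map⁻ ∁ x∈ | ∈-map⁻ ∁ y∈ | ∈-map⁻ ∁ z∈
  ... | A , A∈L , refl | B , B∈L , refl | x , x∈L , refl | y , y∈L , refl | z , z∈L , refl =
    weak B∈L A∈L z∈L y∈L x∈L (between A<z<B) (between A<y<B) (between A<x<B)
      (λ s → y⊈z (p⊆q⇒∁p⊇∁q s)) (λ s → z⊈y (p⊆q⇒∁p⊇∁q s))
      (λ s → x⊈y (p⊆q⇒∁p⊇∁q s)) (λ s → y⊈x (p⊆q⇒∁p⊇∁q s)) (∁p⊂∁q⇒p⊃q x⊂z)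
  within′ : Within (∁ B) (∁ A) (map ∁ L)
  within′ g∈ with ∈-map⁻ ∁ g∈
  ... | g , g∈L , refl = p⊆q⇒∁p⊇∁q (proj₂ (within g∈L)) , p⊆q⇒∁p⊇∁q (proj₁ (within g∈L))
  ∁B∉ : ∁ B ∉ map ∁ L
  ∁B∉ ∁B∈ with ∈-map⁻ ∁ ∁B∈
  ... | g , g∈L , eq with refl ← ∁-injective {A = B} {g} eq = B∉L g∈L
-- With both ends in the family, local weakness at these ends makes the interior a weak order, and
-- 12 + 7 = 19.
... | yes A∈L | yes B∈L = ≤-trans
  (closedBound (suc m) A⊆B dAB unique within
    (openBound (suc m) A⊆B dAB (Unique.filter⁺ (∁? (_≟ˢ B)) (Unique.filter⁺ (∁? (_≟ˢ A)) unique))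
      (interior-inside {L = L} within)
      (λ x∈ y∈ z∈ → weak A∈L B∈L (sub x∈) (sub y∈) (sub z∈)
        (interior-inside {L = L} within x∈) (interior-inside {L = L} within y∈) (interior-inside {L = L} within z∈))))
  (*-monoˡ-≤ (suc m !) (≤-trans (≤-reflexive (closedMass≡12+ m)) (+-monoʳ-≤ 12 (openMass≤7 (suc m)))))
  where
  sub : ∀ {g} → g ∈ interior A B L → g ∈ L
  sub = proj₁ ∘ interior⊆ A B {L}

-- From the Lubell mass to the size of the family

-- Log-convexity of the factorial: the `i` factors that extend `u !` are termwise at most those that
-- extend `w !`.
!-shift : ∀ i {u w} → u ≤ w → (u + i) ! * w ! ≤ u ! * (w + i) !
!-shift zero {u} {w} u≤w = ≤-reflexive (cong₂ (λ x y → x ! * y !) (+-identityʳ u) (sym (+-identityʳ w)))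
!-shift (suc i) {u} {w} u≤w = begin
  (u + suc i) ! * w ! ≡⟨ cong (λ x → x ! * w !) (+-suc u i) ⟩
  suc (u + i) * (u + i) ! * w ! ≡⟨ *-assoc (suc (u + i)) ((u + i) !) (w !) ⟩
  suc (u + i) * ((u + i) ! * w !) ≤⟨ *-mono-≤ (s≤s (+-monoˡ-≤ i u≤w)) (!-shift i u≤w) ⟩
  suc (w + i) * (u ! * (w + i) !) ≡⟨ lem (suc (w + i)) (u !) _ ⟩
  u ! * (suc (w + i) * (w + i) !) ≡⟨ cong (λ x → u ! * x !) (+-suc w i) ⟨
  u ! * (w + suc i) ! ∎
  where
  open ≤-Reasoning
  lem : ∀ a b c → a * (b * c) ≡ b * (a * c)
  lem = solve-∀

-- Moving `i` units away from the balanced split raises the product, by `!-shift`. In the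
-- application `e` is the parity of the total.
!-balanced : ∀ {e} s r h → e ≤ 1 → s + r ≡ h + (e + h) → h ! * (e + h) ! ≤ s ! * r !
!-balanced {e} s r h e≤1 eq with <-≤-connex h s
... | inj₂ s≤h with i , refl ← m≤n⇒∃[o]m+o≡n s≤h = subst (λ x → (s + i) ! * (e + (s + i)) ! ≤ s ! * x !)
  (+-cancelˡ-≡ s _ _ (trans (lem s i e) (sym eq)))
  (!-shift i (≤-trans (m≤m+n s i) (m≤n+m (s + i) e)))
  where
  lem : ∀ s i e → s + (e + (s + i) + i) ≡ s + i + (e + (s + i))
  lem = solve-∀
... | inj₁ h<s with i , refl ← m≤n⇒∃[o]m+o≡n h<s = begin
  h ! * (e + h) ! ≡⟨ *-comm (h !) _ ⟩
  (e + h) ! * h ! ≡⟨ cong (λ x → x ! * h !) e+h≡ ⟩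
  (r + suc i) ! * h ! ≤⟨ !-shift (suc i) r≤h ⟩
  r ! * (h + suc i) ! ≡⟨ *-comm (r !) _ ⟩
  (h + suc i) ! * r ! ≡⟨ cong (λ x → x ! * r !) (+-suc h i) ⟩
  (suc h + i) ! * r ! ∎
  where
  open ≤-Reasoning
  lem : ∀ h i r → suc h + i + r ≡ h + (r + suc i)
  lem = solve-∀
  e+h≡ : e + h ≡ r + suc i
  e+h≡ = +-cancelˡ-≡ h _ _ (trans (sym eq) (lem h i r))
  r≤h : r ≤ h
  r≤h = ≤-pred (begin
    suc r ≤⟨ s≤s (m≤m+n r i) ⟩
    suc (r + i) ≡⟨ +-suc r i ⟨
    r + suc i ≡⟨ e+h≡ ⟨
    e + h ≤⟨ +-monoˡ-≤ h e≤1 ⟩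
    suc h ∎)

halves : ∀ n → n ≡ n / 2 + (n % 2 + n / 2)
halves n = trans (m≡m%n+[m/n]*n n 2) (lem (n % 2) (n / 2))
  where
  lem : ∀ e h → e + h * 2 ≡ h + (e + h)
  lem = solve-∀

n%2≤1 : ∀ n → n % 2 ≤ 1
n%2≤1 n = ≤-pred (m%n<n n 2)

centralBinom≡ : ∀ n → centralBinom n ≡ binom (n / 2) (n % 2 + n / 2)
centralBinom≡ n = trans (cong (_C (n / 2)) (halves n)) (C≡binom (n / 2) (n % 2 + n / 2))

∑-const : ∀ {X : Set} (xs : List X) c → ∑ xs (λ _ → c) ≡ length xs * c
∑-const [] c = refl
∑-const (_ ∷ xs) c = cong (c +_) (∑-const xs c)

d⊥⊤ : ∀ n → d (⊥ {n}) ⊤ ≡ n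
d⊥⊤ n = trans (cong ∣_∣ (p─⊥≡p (⊤ {n}))) (∣⊤∣≡n n)

-- The fraction of chains through `g` is the reciprocal of a binomial coefficient of `n`, and the
-- central one is the largest.
n!≤central*ω : ∀ (g : Subset n) → n ! ≤ centralBinom n * ω ⊥ ⊤ g
n!≤central*ω {n} g = begin
  n ! ≡⟨ cong _! (halves n) ⟩
  (h + (e + h)) ! ≡⟨ binom-! h (e + h) ⟨
  binom h (e + h) * (h ! * (e + h) !) ≡⟨ cong (_* (h ! * (e + h) !)) (centralBinom≡ n) ⟨
  centralBinom n * (h ! * (e + h) !) ≤⟨ *-monoʳ-≤ (centralBinom n) (!-balanced (d ⊥ g) (d g ⊤) h (n%2≤1 n)
    (trans (d-trans (⊆-min g) (⊆-max g)) (trans (d⊥⊤ n) (halves n)))) ⟩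
  centralBinom n * ω ⊥ ⊤ g ∎
  where
  open ≤-Reasoning
  h = n / 2
  e = n % 2

upperBound : ∀ (𝓕 : Family n) → Good n 𝓕 → 6 * length 𝓕 ≤ 19 * centralBinom n
upperBound {n} 𝓕 good = *-cancelʳ-≤ _ _ (n !) {{n !≢0}} (begin
  6 * length 𝓕 * n ! ≡⟨ *-assoc 6 (length 𝓕) (n !) ⟩
  6 * (length 𝓕 * n !) ≡⟨ cong (6 *_) (∑-const 𝓕 (n !)) ⟨
  6 * ∑ 𝓕 (λ _ → n !) ≤⟨ *-monoʳ-≤ 6 (∑-mono 𝓕 (λ {g} _ → n!≤central*ω g)) ⟩
  6 * ∑ 𝓕 (λ g → centralBinom n * ω ⊥ ⊤ g) ≡⟨ cong (6 *_) (∑-*ˡ 𝓕 (centralBinom n)) ⟩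
  6 * (centralBinom n * ∑ 𝓕 (ω ⊥ ⊤)) ≡⟨ lem (centralBinom n) _ ⟩
  centralBinom n * (6 * ∑ 𝓕 (ω ⊥ ⊤)) ≤⟨ *-monoʳ-≤ (centralBinom n)
    (lubellBound n (⊆-min ⊤) (d⊥⊤ n) (proj₁ good) (good⇒locallyWeak 𝓕 good) (λ {g} _ → ⊆-min g , ⊆-max g)) ⟩
  centralBinom n * (19 * n !) ≡⟨ lem′ (centralBinom n) (n !) ⟩
  19 * centralBinom n * n ! ∎)
  where
  open ≤-Reasoning
  lem : ∀ c s → 6 * (c * s) ≡ c * (6 * s)
  lem = solve-∀
  lem′ : ∀ c f → c * (19 * f) ≡ 19 * c * f
  lem′ = solve-∀

-- Lower bound: three middle layers

layer : ∀ n → ℕ → Family n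
layer zero zero = [] ∷ []
layer zero (suc k) = []
layer (suc n) zero = map (outside ∷_) (layer n zero)
layer (suc n) (suc k) = map (inside ∷_) (layer n k) ++ map (outside ∷_) (layer n (suc k))

length-layer : ∀ n k → length (layer n k) ≡ n C k
length-layer zero zero = refl
length-layer zero (suc k) = sym (k>n⇒nCk≡0 {0} {suc k} (s≤s z≤n))
length-layer (suc n) zero = trans (length-map (outside ∷_) (layer n zero)) (length-layer n zero)
length-layer (suc n) (suc k) = begin
  length (map (inside ∷_) (layer n k) ++ map (outside ∷_) (layer n (suc k)))
    ≡⟨ length-++ (map (inside ∷_) (layer n k)) ⟩
  length (map (inside ∷_) (layer n k)) + length (map (outside ∷_) (layer n (suc k)))
    ≡⟨ cong₂ _+_ (length-map (inside ∷_) (layer n k)) (length-map (outside ∷_) (layer n (suc k))) ⟩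
  length (layer n k) + length (layer n (suc k)) ≡⟨ cong₂ _+_ (length-layer n k) (length-layer n (suc k)) ⟩
  n C k + n C suc k ≡⟨ nCk+nC[k+1]≡[n+1]C[k+1] n k ⟩
  suc n C suc k ∎
  where open ≡-Reasoning

∈-layer : ∀ n k {g} → g ∈ layer n k → ∣ g ∣ ≡ k
∈-layer zero zero (here refl) = refl
∈-layer (suc n) zero g∈ with ∈-map⁻ (outside ∷_) g∈
... | g′ , g′∈ , refl = ∈-layer n zero g′∈
∈-layer (suc n) (suc k) g∈ with ∈-++⁻ (map (inside ∷_) (layer n k)) g∈
... | inj₁ g∈ with g′ , g′∈ , refl ← ∈-map⁻ (inside ∷_) g∈ = cong suc (∈-layer n k g′∈)
... | inj₂ g∈ with g′ , g′∈ , refl ← ∈-map⁻ (outside ∷_) g∈ = ∈-layer n (suc k) g′∈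

layer-unique : ∀ n k → Unique (layer n k)
layer-unique zero zero = [] ∷ []
layer-unique zero (suc k) = []
layer-unique (suc n) zero = Unique.map⁺ ∷-injectiveʳ (layer-unique n zero)
layer-unique (suc n) (suc k) = Unique.++⁺ (Unique.map⁺ ∷-injectiveʳ (layer-unique n k))
  (Unique.map⁺ ∷-injectiveʳ (layer-unique n (suc k))) disjoint
  where
  disjoint : ∀ {g} → ¬ (g ∈ map (inside ∷_) (layer n k) × g ∈ map (outside ∷_) (layer n (suc k)))
  disjoint (g∈ , g∈′) with ∈-map⁻ (inside ∷_) g∈ | ∈-map⁻ (outside ∷_) g∈′
  ... | _ , _ , refl | _ , _ , ()

threeLayers : ∀ n → ℕ → Family n
threeLayers n p = layer n p ++ (layer n (1 + p) ++ layer n (2 + p))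

∈-threeLayers : ∀ n p {g} → g ∈ threeLayers n p → p ≤ ∣ g ∣ × ∣ g ∣ ≤ 2 + p
∈-threeLayers n p g∈ with ∈-++⁻ (layer n p) g∈
... | inj₁ g∈ with refl ← ∈-layer n p g∈ = ≤-refl , m≤n+m _ 2
... | inj₂ g∈ with ∈-++⁻ (layer n (1 + p)) g∈
... | inj₁ g∈ = ≤-trans (n≤1+n p) (≤-reflexive (sym (∈-layer n (1 + p) g∈))) ,
  ≤-trans (≤-reflexive (∈-layer n (1 + p) g∈)) (n≤1+n (1 + p))
... | inj₂ g∈ = ≤-trans (m≤n+m p 2) (≤-reflexive (sym (∈-layer n (2 + p) g∈))) ,
  ≤-reflexive (∈-layer n (2 + p) g∈)

-- Cardinality is a proper coloring, and both middle elements of a diamond must lie in layer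
-- `1 + p`, so they share a color.
threeLayers-good : ∀ n p → Good n (threeLayers n p)
threeLayers-good n p = unique , ∣_∣ , (λ F F′ _ _ F⊂F′ → <⇒≢ (p⊂q⇒∣p∣<∣q∣ F⊂F′)) , noRainbow
  where
  unique : Unique (threeLayers n p)
  unique = Unique.++⁺ (layer-unique n p)
    (Unique.++⁺ (layer-unique n (1 + p)) (layer-unique n (2 + p))
      (λ { (g∈ , g∈′) → m≢1+m+n (1 + p) {0} (trans (sym (∈-layer n (1 + p) g∈))
        (trans (∈-layer n (2 + p) g∈′) (cong (2 +_) (sym (+-identityʳ p))))) }))
    (λ { (g∈ , g∈′) → [ (λ g∈₁ → 1+n≢n (trans (sym (∈-layer n (1 + p) g∈₁)) (∈-layer n p g∈)))
                      , (λ g∈₂ → m≢1+n+m p (trans (sym (∈-layer n p g∈)) (∈-layer n (2 + p) g∈₂)))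
                      ] (∈-++⁻ (layer n (1 + p)) g∈′) })
  middle : ∀ {a b c} → a ∈ threeLayers n p → c ∈ threeLayers n p → a ⊂ b → b ⊂ c → ∣ b ∣ ≡ 1 + p
  middle a∈ c∈ a⊂b b⊂c = ≤-antisym
    (≤-pred (≤-trans (p⊂q⇒∣p∣<∣q∣ b⊂c) (proj₂ (∈-threeLayers n p c∈))))
    (≤-trans (s≤s (proj₁ (∈-threeLayers n p a∈))) (p⊂q⇒∣p∣<∣q∣ a⊂b))
  noRainbow : NoRainbowDiamond (threeLayers n p) ∣_∣
  noRainbow a b c d (a∈ , _ , _ , d∈ , a⊂b , b⊂d , a⊂c , c⊂d , _) (_ , _ , _ , b≢c , _) =
    b≢c (trans (middle a∈ d∈ a⊂b b⊂d) (sym (middle a∈ d∈ a⊂c c⊂d)))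

binom-ratio : ∀ a b → suc a * binom (suc a) b ≡ suc b * binom a (suc b)
binom-ratio a b = *-cancelʳ-≡ _ _ (a ! * b !) {{a !* b !≢0}} (begin
  suc a * binom (suc a) b * (a ! * b !) ≡⟨ lem (suc a) (binom (suc a) b) (a !) (b !) ⟩
  binom (suc a) b * (suc a ! * b !) ≡⟨ binom-! (suc a) b ⟩
  (suc a + b) ! ≡⟨ cong _! (+-suc a b) ⟨
  (a + suc b) ! ≡⟨ binom-! a (suc b) ⟨
  binom a (suc b) * (a ! * suc b !) ≡⟨ lem′ (suc b) (binom a (suc b)) (a !) (b !) ⟩
  suc b * binom a (suc b) * (a ! * b !) ∎)
  where
  open ≡-Reasoning
  lem : ∀ k c x y → k * c * (x * y) ≡ c * (k * x * y)
  lem = solve-∀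
  lem′ : ∀ k c x y → c * (x * (k * y)) ≡ k * c * (x * y)
  lem′ = solve-∀

-- By `binom-ratio` each neighbor is at least (1 + p)/(3 + p) times the middle coefficient. The sum
-- is thus at least 3 - 4/(3 + p) times it, and `4 * k ≤ 3 + p` makes the loss at most 1/k.
threeLayers-binom : ∀ k p q → p ≤ q → q ≤ 1 + p → 4 * k ≤ 3 + p → 1 ≤ k →
  (3 * k ∸ 1) * binom (1 + p) (1 + q) ≤ k * (binom p (2 + q) + (binom (1 + p) (1 + q) + binom (2 + p) q))
threeLayers-binom k p q p≤q q≤1+p 4k≤ 1≤k = *-cancelˡ-≤ (3 + p) (begin
  (3 + p) * (j * c) ≡⟨ *-assoc (3 + p) j c ⟨
  (3 + p) * j * c ≤⟨ *-monoˡ-≤ c coefficient ⟩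
  k * (5 + 3 * p) * c ≡⟨ lem k p c ⟩
  k * ((1 + p) * c + ((3 + p) * c + (1 + p) * c)) ≤⟨ *-monoʳ-≤ k (+-mono-≤ x≥ (+-monoʳ-≤ ((3 + p) * c) y≥)) ⟩
  k * ((3 + p) * x + ((3 + p) * c + (3 + p) * y)) ≡⟨ lem′ k (3 + p) x c y ⟩
  (3 + p) * (k * (x + (c + y))) ∎)
  where
  open ≤-Reasoning
  j = 3 * k ∸ 1
  x = binom p (2 + q)
  c = binom (1 + p) (1 + q)
  y = binom (2 + p) q
  lem : ∀ k p c → k * (5 + 3 * p) * c ≡ k * ((1 + p) * c + ((3 + p) * c + (1 + p) * c))
  lem = solve-∀
  lem′ : ∀ k r x c y → k * (r * x + (r * c + r * y)) ≡ r * (k * (x + (c + y)))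
  lem′ = solve-∀
  lem″ : ∀ k p → (3 + p) * (3 * k) ≡ k * (5 + 3 * p) + 4 * k
  lem″ = solve-∀
  x≥ : (1 + p) * c ≤ (3 + p) * x
  x≥ = ≤-trans (≤-reflexive (binom-ratio p (1 + q))) (*-monoˡ-≤ x (s≤s (s≤s q≤1+p)))
  y≥ : (1 + p) * c ≤ (3 + p) * y
  y≥ = begin
    (1 + p) * c ≤⟨ *-monoˡ-≤ c (s≤s p≤q) ⟩
    (1 + q) * c ≡⟨ binom-ratio (1 + p) q ⟨
    (2 + p) * y ≤⟨ *-monoˡ-≤ y (n≤1+n (2 + p)) ⟩
    (3 + p) * y ∎
  j+1≡ : j + 1 ≡ 3 * k
  j+1≡ = m∸n+n≡m (≤-trans 1≤k (m≤m+n k _))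
  coefficient : (3 + p) * j ≤ k * (5 + 3 * p)
  coefficient = +-cancelʳ-≤ (3 + p) _ _ (begin
    (3 + p) * j + (3 + p) ≡⟨ cong ((3 + p) * j +_) (*-identityʳ (3 + p)) ⟨
    (3 + p) * j + (3 + p) * 1 ≡⟨ *-distribˡ-+ (3 + p) j 1 ⟨
    (3 + p) * (j + 1) ≡⟨ cong ((3 + p) *_) j+1≡ ⟩
    (3 + p) * (3 * k) ≡⟨ lem″ k p ⟩
    k * (5 + 3 * p) + 4 * k ≤⟨ +-monoʳ-≤ (k * (5 + 3 * p)) 4k≤ ⟩
    k * (5 + 3 * p) + (3 + p) ∎)

length-threeLayers : ∀ p q → length (threeLayers ((1 + p) + (1 + q)) p) ≡
  binom p (2 + q) + (binom (1 + p) (1 + q) + binom (2 + p) q)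
length-threeLayers p q = trans (length-++ (layer N p)) (cong₂ _+_
    (trans (length-layer N p) (trans (cong (_C p) (sym (+-suc p (1 + q)))) (C≡binom p (2 + q))))
    (trans (length-++ (layer N (1 + p))) (cong₂ _+_
      (trans (length-layer N (1 + p)) (C≡binom (1 + p) (1 + q)))
      (trans (length-layer N (2 + p)) (trans (cong (_C (2 + p)) (+-suc (1 + p) q)) (C≡binom (2 + p) q))))))
  where
  N : ℕ
  N = (1 + p) + (1 + q)

4k≤n/2 : ∀ k n → 8 * k ≤ n → 4 * k ≤ n / 2
4k≤n/2 k n 8k≤n = ≮⇒≥ λ n/2<4k → <-irrefl refl (begin-strict
  n ≡⟨ halves n ⟩
  n / 2 + (n % 2 + n / 2) ≤⟨ +-monoʳ-≤ (n / 2) (+-monoˡ-≤ (n / 2) (n%2≤1 n)) ⟩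
  n / 2 + suc (n / 2) <⟨ +-mono-≤ n/2<4k n/2<4k ⟩
  4 * k + 4 * k ≡⟨ *-distribʳ-+ k 4 4 ⟨
  8 * k ≤⟨ 8k≤n ⟩
  n ∎)
  where open ≤-Reasoning

lowerBound : ∀ k n → 1 ≤ k → 8 * k ≤ n →
  ∃[ 𝓕 ] (Good n 𝓕 × (3 * k ∸ 1) * centralBinom n ≤ k * length 𝓕)
lowerBound k n 1≤k 8k≤n with n / 2 in h≡ | 4k≤n/2 k n 8k≤n
... | zero | 4k≤0 = contradiction (≤-trans (*-monoʳ-≤ 4 1≤k) 4k≤0) λ ()
-- With `n / 2` equal to `1 + p`, starting at layer `p` puts the central layer in the middle.
... | suc p | 4k≤1+p = threeLayers n p , threeLayers-good n p ,
  subst₂ (λ c l → (3 * k ∸ 1) * c ≤ k * l) (sym central≡) (sym length≡)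
    (threeLayers-binom k p q (m≤n+m p e) (+-monoˡ-≤ p (n%2≤1 n)) (≤-trans 4k≤1+p (m≤n+m (1 + p) 2)) 1≤k)
  where
  e = n % 2
  q = e + p
  n≡ : n ≡ (1 + p) + (1 + q)
  n≡ = trans (halves n) (trans (cong (λ h → h + (e + h)) h≡) (cong ((1 + p) +_) (+-suc e p)))
  central≡ : n C (suc p) ≡ binom (1 + p) (1 + q)
  central≡ = trans (cong (_C (1 + p)) n≡) (C≡binom (1 + p) (1 + q))
  length≡ : length (threeLayers n p) ≡ binom p (2 + q) + (binom (1 + p) (1 + q) + binom (2 + p) q)
  length≡ = trans (cong (λ n → length (threeLayers n p)) n≡) (length-threeLayers p q)

-- Each o(1) is expressed by an error 1/k for arbitrary `k`, with denominators cleared: (19k +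
-- 6)/(6k) = 3 + 1/6 + 1/k.
theorem1p8 : ∀ (k : ℕ) → 1 ≤ k → ∃[ N ] ∀ (n : ℕ) → N ≤ n →
    (∃[ 𝓕 ] (Good n 𝓕 × (3 * k ∸ 1) * centralBinom n ≤ k * length 𝓕))
    × (∀ 𝓕 → Good n 𝓕 → 6 * k * length 𝓕 ≤ (19 * k + 6) * centralBinom n)
-- From `8 * k` on, `n / 2` is at least `4 * k`, which brings the loss of the outer layers below
-- 1/k.
theorem1p8 k 1≤k = 8 * k , λ n 8k≤n → lowerBound k n 1≤k 8k≤n , λ 𝓕 good → begin
  6 * k * length 𝓕 ≡⟨ lem 6 k (length 𝓕) ⟩
  k * (6 * length 𝓕) ≤⟨ *-monoʳ-≤ k (upperBound 𝓕 good) ⟩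
  k * (19 * centralBinom n) ≡⟨ lem 19 k (centralBinom n) ⟨
  19 * k * centralBinom n ≤⟨ *-monoˡ-≤ (centralBinom n) (m≤m+n (19 * k) 6) ⟩
  (19 * k + 6) * centralBinom n ∎
  where
  open ≤-Reasoning
  lem : ∀ a k x → a * k * x ≡ k * (a * x)
  lem = solve-∀
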